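{- For every positive integer $D$, there exist a 2-degenerate graph $G$ with $\Delta(G)\le D$ and a clique $S'$ in $G^2$ with $|S'|\ge g(D)-460$.
   Context: $g(D)$ denotes the maximum size of a clique in $G^2$ over all graphs $G$ with $\mathrm{mad}(G)<4$ and $\Delta(G)\le D$, where $\mathrm{mad}(G)=\max_{H\subseteq G}2|E(H)|/|V(H)|$. The square $G^2$ is obtained from $G$ by adding an edge between every pair of vertices at distance 2 in $G$. -}

module Defs where

open import Data.Nat as ℕ using (ℕ; NonZero)
import Data.Integer as ℤ
open import Data.Rational as ℚ using (ℚ)
open import Data.Fin using (Fin)
open import Data.Fin.Properties using (_≟_; _<?_; any?)
open import Data.Fin.Subset using (Subset; _∈_; _⊆_; ∣_∣; Nonempty)
open import Data.List using (List; length; map; filter; allFin; cartesianProduct)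
open import Data.List.Extrema.Nat using (max)
open import Data.Product using (_×_; _,_; ∃-syntax; Σ-syntax)
open import Data.Sum using (_⊎_; inj₁; inj₂)
open import Function using (_∘_)
open import Level using (0ℓ; _⊔_)
open import Relation.Binary using (Rel; Symmetric; Irreflexive; Decidable)
open import Relation.Binary.PropositionalEquality using (_≡_; _≢_; sym)
open import Relation.Nullary using (¬_; ¬?; _×-dec_; _⊎-dec_)

-- A finite simple graph whose vertex set V is a subset of Fin n.  Letting V be
-- a subset of an ambient Fin n means that a graph and its subgraphs (which may
-- omit vertices as well as edges) have the same type.
record Graph (n : ℕ) : Set₁ where
  field
    V          : Subset n
    Adj        : Rel (Fin n) 0ℓ
    Adj?       : Decidable Adj
    Adj-sym    : Symmetric Adj
    Adj-irrefl : Irreflexive _≡_ Adj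
    Adj⇒∈V     : ∀ {u v} → Adj u v → u ∈ V

open Graph public

private variable
  n : ℕ

∣V∣ : Graph n → ℕ
∣V∣ G = ∣ V G ∣

-- Each edge is listed once, with its smaller endpoint first.
edges : Graph n → List (Fin n × Fin n)
edges {n} G =
  filter (λ (u , v) → (u <? v) ×-dec Adj? G u v)
         (cartesianProduct (allFin n) (allFin n))

∣E∣ : Graph n → ℕ
∣E∣ G = length (edges G)

deg : Graph n → Fin n → ℕ
deg {n} G v = length (filter (Adj? G v) (allFin n))

-- Elements of Fin n outside V G have degree 0, so they do not affect the maximum.
Δ : Graph n → ℕ
Δ {n} G = max 0 (map (deg G) (allFin n))

record _⊆ᴳ_ (H G : Graph n) : Set where
  field
    V⊆   : V H ⊆ V G
    Adj⊆ : ∀ {u v} → Adj H u v → Adj G u v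

IsMaximum : ∀ {a ℓ p} {A : Set a} → Rel A ℓ → (A → Set p) → A → Set (a ⊔ ℓ ⊔ p)
IsMaximum _≤_ P m = P m × (∀ {x} → P x → x ≤ m)

averageDegree : (G : Graph n) → .{{NonZero (∣V∣ G)}} → ℚ
averageDegree G = ℤ.+ (2 ℕ.* ∣E∣ G) ℚ./ ∣V∣ G

-- q is the average degree of some subgraph of G with at least one vertex.
SubgraphAverageDegree : Graph n → ℚ → Set₁
SubgraphAverageDegree {n} G q =
  Σ[ H ∈ Graph n ] H ⊆ᴳ G ×
    Σ[ nonZero ∈ NonZero (∣V∣ H) ] q ≡ averageDegree H {{nonZero}}

-- m = mad(G).  The graph without vertices has no maximum average degree.
IsMad : Graph n → ℚ → Set₁
IsMad G = IsMaximum ℚ._≤_ (SubgraphAverageDegree G)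

Mad< : Graph n → ℚ → Set₁
Mad< G q = ∃[ m ] IsMad G m × m ℚ.< q

Degenerate : ℕ → Graph n → Set₁
Degenerate {n} k G =
  (H : Graph n) → H ⊆ᴳ G → Nonempty (V H) → ∃[ v ] v ∈ V H × deg H v ℕ.≤ k

AtDistance2 : Graph n → Rel (Fin n) 0ℓ
AtDistance2 G u v = u ≢ v × ¬ Adj G u v × (∃[ w ] Adj G u w × Adj G w v)

infix 8 _²

_² : Graph n → Graph n
G ² = record
  { V          = V G
  ; Adj        = λ u v → Adj G u v ⊎ AtDistance2 G u v
  ; Adj?       = λ u v → Adj? G u v ⊎-dec
                   (¬? (u ≟ v) ×-dec ¬? (Adj? G u v) ×-dec
                    any? (λ w → Adj? G u w ×-dec Adj? G w v))
  ; Adj-sym    = λ where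
      (inj₁ uv)                       → inj₁ (Adj-sym G uv)
      (inj₂ (u≢v , ¬uv , w , uw , wv)) →
        inj₂ (u≢v ∘ sym , ¬uv ∘ Adj-sym G , w , Adj-sym G wv , Adj-sym G uw)
  ; Adj-irrefl = λ where
      u≡v (inj₁ uv)        → Adj-irrefl G u≡v uv
      u≡v (inj₂ (u≢v , _)) → u≢v u≡v
  ; Adj⇒∈V     = λ where
      (inj₁ uv)                    → Adj⇒∈V G uv
      (inj₂ (_ , _ , _ , uw , _)) → Adj⇒∈V G uw
  }

record IsClique (G : Graph n) (S : Subset n) : Set where
  field
    ⊆V       : S ⊆ V G
    adjacent : ∀ {u v} → u ∈ S → v ∈ S → u ≢ v → Adj G u v

-- k is the size of a clique in G² for some G with mad(G) < 4 and Δ(G) ≤ D.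
SquareCliqueSize : ℕ → ℕ → Set₁
SquareCliqueSize D k =
  ∃[ n ] Σ[ G ∈ Graph n ] Mad< G (ℤ.+ 4 ℚ./ 1) × Δ G ℕ.≤ D ×
    (∃[ S ] IsClique (G ²) S × ∣ S ∣ ≡ k)

-- m = g(D).  The maximum exists for every D, since a clique in G² has at most
-- Δ(G)² + 1 vertices and the graph with one vertex has mad 0.
IsG : ℕ → ℕ → Set₁
IsG D = IsMaximum ℕ._≤_ (SquareCliqueSize D)

{-# OPTIONS --safe #-}

-- Since mad(G) < 4, Hakimi's theorem orients G with all outdegrees at most 2.  Let S be a clique
-- of G² of size s, and let h(w) be the number of vertices of S with out-neighbour w.  Two vertices
-- of S that do not share an out-neighbour are adjacent, or joined by a directed path of length 2
-- (both happen for O(s) pairs only), or have a common in-neighbour (at most D such partners for each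
-- vertex).  If s exceeds 5D/2, this forces every out-neighbour of almost every vertex of S to be a
-- hub, i.e. to satisfy h ≥ s/10.  There are at most 20 hubs and they have at most 40 out-neighbours;
-- after removing these from S, all out-neighbours of the remaining set S′ are hubs.  The edges that
-- touch S′ therefore form a 2-degenerate graph: first the hubs, then S′, then everything else.  If
-- s is smaller, then a blow-up of the pentagon does.

module Submission where

import Data.Empty as Empty
import Data.Fin.Properties as Fin
import Data.Integer as ℤ
import Data.Integer.Properties as ℤ
import Data.List.Extrema.Nat as Extrema
import Data.List.Relation.Unary.All.Properties as All
import Data.Product.Properties as ×
import Data.Rational as ℚ
import Data.Rational.Properties as ℚ
import Data.Rational.Unnormalised as ℚᵘ
import Data.Rational.Unnormalised.Properties as ℚᵘ
import Data.Sum.Properties as ⊎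
open import Data.Bool.Base using (true; false; if_then_else_)
open import Data.Fin as Fin using (Fin; zero; suc)
open import Data.Fin.Patterns using (0F; 1F; 2F; 3F; 4F)
open import Data.Fin.Properties using (_≟_; all?; any?; +↔⊎; *↔×)
open import Data.Fin.Subset
  using (Subset; inside; outside; _∈_; _∉_; _⊆_; ∣_∣; Nonempty; _∪_; _∩_; _─_; _-_; ⁅_⁆; ⊤; ⊥)
open import Data.Fin.Subset.Properties
open import Data.List as List using (List; []; _∷_; length; filter; allFin; cartesianProduct)
open import Data.List.Membership.Propositional.Properties
  using (∈-allFin; ∈-cartesianProduct⁺; ∈-filter⁺)
open import Data.List.Properties using (filter-++; length-++; map-tabulate)
open import Data.List.Relation.Unary.All as All using (All; []; _∷_)
open import Data.Nat
  using (ℕ; zero; suc; _+_; _*_; _≤_; _<_; _≥_; z≤n; s≤s; s≤s⁻¹; _≤?_; _<?_; NonZero; >-nonZero)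
open import Data.Nat.Properties hiding (_≟_; _≤?_; _<?_; suc-injective)
open import Data.Nat.Solver using (module +-*-Solver)
open import Data.Product using (_×_; _,_; proj₁; proj₂; ∃-syntax; Σ-syntax)
open import Data.Product.Function.NonDependent.Propositional using (_×-↔_)
open import Data.Sum as Sum using (_⊎_; inj₁; inj₂; [_,_]′)
open import Data.Sum.Function.Propositional using (_⊎-↔_)
open import Data.Vec as Vec using ([]; _∷_; there)
open import Data.Vec.Functional using (updateAt)
open import Data.Vec.Functional.Properties using (updateAt-updates; updateAt-minimal)
open import Data.Vec.Properties using (lookup∘tabulate; []=⇒lookup; lookup⇒[]=)
open import Function using (_∘_; id; _↔_; Injective; Injection; Inverse)
open import Function.Properties.Inverse using (↔-refl; ↔-trans; ↔-sym; ↔⇒↣)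
open import Level using (0ℓ)
open import Relation.Binary
  using (Rel; Decidable; DecidableEquality; tri<; tri≈; tri>)
open import Relation.Binary.PropositionalEquality
open import Relation.Nullary
  using (¬_; ¬?; Dec; yes; no; does; from-yes; _×-dec_; _⊎-dec_; contradiction)
open import Relation.Unary using (Pred) renaming (Decidable to Decidable₁)
open import Algebra.Properties.Semiring.Sum +-*-semiring
  using (sum; ∑-comm; ∑-distrib-+; *-distribˡ-sum; sum-cong-≗)
open import Defs

private variable
  m n : ℕ

-- Counting in finite sets

𝟙 : ∀ {p} {P : Set p} → Dec P → ℕ
𝟙 d = if does d then 1 else 0

𝟙-yes : ∀ {p} {P : Set p} (d : Dec P) → P → 𝟙 d ≡ 1
𝟙-yes (yes _) _ = refl
𝟙-yes (no ¬p) p = contradiction p ¬p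

𝟙-no : ∀ {p} {P : Set p} (d : Dec P) → ¬ P → 𝟙 d ≡ 0
𝟙-no (yes p) ¬p = contradiction p ¬p
𝟙-no (no _)  _  = refl

𝟙-mono : ∀ {p q} {P : Set p} {Q : Set q} (d : Dec P) (e : Dec Q) → (P → Q) → 𝟙 d ≤ 𝟙 e
𝟙-mono (yes p) e f = ≤-reflexive (sym (𝟙-yes e (f p)))
𝟙-mono (no _)  e f = z≤n

sum-mono : {f g : Fin n → ℕ} → (∀ i → f i ≤ g i) → sum f ≤ sum g
sum-mono {zero}  f≤g = z≤n
sum-mono {suc n} f≤g = +-mono-≤ (f≤g zero) (sum-mono (f≤g ∘ suc))

sum-mono-< : {f g : Fin n → ℕ} → (∀ i → f i ≤ g i) → ∀ i → f i < g i → sum f < sum g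
sum-mono-< f≤g zero    fi<gi = +-mono-<-≤ fi<gi (sum-mono (f≤g ∘ suc))
sum-mono-< f≤g (suc i) fi<gi = +-mono-≤-< (f≤g zero) (sum-mono-< (f≤g ∘ suc) i fi<gi)

term≤sum : (f : Fin n → ℕ) → ∀ i → f i ≤ sum f
term≤sum f zero    = m≤m+n _ _
term≤sum f (suc i) = ≤-trans (term≤sum (f ∘ suc) i) (m≤n+m _ _)

∣p∣≡sum : (p : Subset n) → ∣ p ∣ ≡ sum (λ x → 𝟙 (x ∈? p))
∣p∣≡sum []            = refl
∣p∣≡sum (inside  ∷ p) = cong suc (∣p∣≡sum p)
∣p∣≡sum (outside ∷ p) = ∣p∣≡sum p

∣p∪q∣≤∣p∣+∣q∣ : (p q : Subset n) → ∣ p ∪ q ∣ ≤ ∣ p ∣ + ∣ q ∣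
∣p∪q∣≤∣p∣+∣q∣ []            []            = z≤n
∣p∪q∣≤∣p∣+∣q∣ (outside ∷ p) (outside ∷ q) = ∣p∪q∣≤∣p∣+∣q∣ p q
∣p∪q∣≤∣p∣+∣q∣ (outside ∷ p) (inside  ∷ q) =
  ≤-trans (s≤s (∣p∪q∣≤∣p∣+∣q∣ p q)) (≤-reflexive (sym (+-suc _ _)))
∣p∪q∣≤∣p∣+∣q∣ (inside  ∷ p) (t       ∷ q) =
  s≤s (≤-trans (∣p∪q∣≤∣p∣+∣q∣ p q) (+-monoʳ-≤ ∣ p ∣ (∣p∣≤∣x∷p∣ t q)))

x∈p─q⇒x∉q : {x : Fin n} (p q : Subset n) → x ∈ p ─ q → x ∉ q
x∈p─q⇒x∉q (_ ∷ p) (outside ∷ q) (there x∈) (there x∈q) = x∈p─q⇒x∉q p q x∈ x∈q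
x∈p─q⇒x∉q (_ ∷ p) (inside  ∷ q) (there x∈) (there x∈q) = x∈p─q⇒x∉q p q x∈ x∈q

x∉p-x : (x : Fin n) (p : Subset n) → x ∉ p - x
x∉p-x x p x∈ = x∈p─q⇒x∉q p ⁅ x ⁆ x∈ (x∈⁅x⁆ x)

select : ∀ {ℓ} {P : Pred (Fin n) ℓ} → Decidable₁ P → Subset n
select P? = Vec.tabulate (does ∘ P?)

module _ {ℓ} {P : Pred (Fin n) ℓ} (P? : Decidable₁ P) where

  ∈-select⁺ : ∀ {x} → P x → x ∈ select P?
  ∈-select⁺ {x} px = lookup⇒[]= x _ (trans (lookup∘tabulate _ x) does≡true)
    where
    does≡true : does (P? x) ≡ true
    does≡true with P? x
    ... | yes _  = refl
    ... | no ¬px = contradiction px ¬px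

  ∈-select⁻ : ∀ {x} → x ∈ select P? → P x
  ∈-select⁻ {x} x∈ with P? x | trans (sym (lookup∘tabulate (does ∘ P?) x)) ([]=⇒lookup x∈)
  ... | yes px | _ = px
  ... | no _   | ()

∑∈ : Subset n → (Fin n → ℕ) → ℕ
∑∈ p f = sum (λ x → 𝟙 (x ∈? p) * f x)

⋃∈-member? : (p : Subset m) (F : Fin m → Subset n) →
             Decidable₁ (λ v → ∃[ w ] w ∈ p × v ∈ F w)
⋃∈-member? p F v = any? (λ w → (w ∈? p) ×-dec (v ∈? F w))

⋃∈ : Subset m → (Fin m → Subset n) → Subset n
⋃∈ p F = select (⋃∈-member? p F)

∈-⋃∈⁺ : (p : Subset m) (F : Fin m → Subset n) {v : Fin n} {w : Fin m} → w ∈ p → v ∈ F w → v ∈ ⋃∈ p F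
∈-⋃∈⁺ p F w∈p v∈Fw = ∈-select⁺ (⋃∈-member? p F) (_ , w∈p , v∈Fw)

∈-⋃∈⁻ : (p : Subset m) (F : Fin m → Subset n) {v : Fin n} →
        v ∈ ⋃∈ p F → ∃[ w ] w ∈ p × v ∈ F w
∈-⋃∈⁻ p F = ∈-select⁻ (⋃∈-member? p F)

∑∈-mono : (p : Subset n) {f g : Fin n → ℕ} → (∀ {x} → x ∈ p → f x ≤ g x) → ∑∈ p f ≤ ∑∈ p g
∑∈-mono p {f} {g} f≤g = sum-mono term-mono
  where
  term-mono : ∀ x → 𝟙 (x ∈? p) * f x ≤ 𝟙 (x ∈? p) * g x
  term-mono x with x ∈? p
  ... | yes x∈p = +-mono-≤ (f≤g x∈p) z≤n
  ... | no _    = z≤n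

∑∈-const : (p : Subset n) (k : ℕ) → ∑∈ p (λ _ → k) ≡ k * ∣ p ∣
∑∈-const p k = begin
  ∑∈ p (λ _ → k)                       ≡⟨ sum-cong-≗ (λ x → *-comm (𝟙 (x ∈? p)) k) ⟩
  sum (λ x → k * 𝟙 (x ∈? p))           ≡⟨ *-distribˡ-sum k (λ x → 𝟙 (x ∈? p)) ⟨
  k * sum (λ x → 𝟙 (x ∈? p))           ≡⟨ cong (k *_) (∣p∣≡sum p) ⟨
  k * ∣ p ∣                            ∎
  where open ≡-Reasoning

∑∈-bound : (p : Subset n) {f : Fin n → ℕ} (k : ℕ) → (∀ {x} → x ∈ p → f x ≤ k) →
           ∑∈ p f ≤ k * ∣ p ∣
∑∈-bound p k f≤k = ≤-trans (∑∈-mono p f≤k) (≤-reflexive (∑∈-const p k))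

∣⋃∈∣≤∑∈ : (p : Subset m) (F : Fin m → Subset n) → ∣ ⋃∈ p F ∣ ≤ ∑∈ p (∣_∣ ∘ F)
∣⋃∈∣≤∑∈ p F = begin
  ∣ ⋃∈ p F ∣                                                ≡⟨ ∣p∣≡sum (⋃∈ p F) ⟩
  sum (λ v → 𝟙 (v ∈? ⋃∈ p F))                               ≤⟨ sum-mono pointwise ⟩
  sum (λ v → sum (λ w → 𝟙 (w ∈? p) * 𝟙 (v ∈? F w)))         ≡⟨ ∑-comm (λ v w → 𝟙 (w ∈? p) * 𝟙 (v ∈? F w)) ⟩
  sum (λ w → sum (λ v → 𝟙 (w ∈? p) * 𝟙 (v ∈? F w)))         ≡⟨ sum-cong-≗ (λ w → *-distribˡ-sum (𝟙 (w ∈? p)) (λ v → 𝟙 (v ∈? F w))) ⟨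
  sum (λ w → 𝟙 (w ∈? p) * sum (λ v → 𝟙 (v ∈? F w)))         ≡⟨ sum-cong-≗ (λ w → cong (𝟙 (w ∈? p) *_) (∣p∣≡sum (F w))) ⟨
  ∑∈ p (∣_∣ ∘ F)                                            ∎
  where
  open ≤-Reasoning
  pointwise : ∀ v → 𝟙 (v ∈? ⋃∈ p F) ≤ sum (λ w → 𝟙 (w ∈? p) * 𝟙 (v ∈? F w))
  pointwise v with v ∈? ⋃∈ p F
  ... | no _ = z≤n
  ... | yes v∈ with ∈-⋃∈⁻ p F v∈
  ...   | w , w∈p , v∈Fw = ≤-trans
          (≤-reflexive (sym (cong₂ _*_ (𝟙-yes (w ∈? p) w∈p) (𝟙-yes (v ∈? F w) v∈Fw))))
          (term≤sum _ w)

∣p∩q∣≡∑∈ : (p q : Subset n) → ∣ p ∩ q ∣ ≡ ∑∈ q (λ x → 𝟙 (x ∈? p))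
∣p∩q∣≡∑∈ p q = trans (∣p∣≡sum (p ∩ q)) (sum-cong-≗ pointwise)
  where
  pointwise : ∀ x → 𝟙 (x ∈? p ∩ q) ≡ 𝟙 (x ∈? q) * 𝟙 (x ∈? p)
  pointwise x with x ∈? p | x ∈? q
  ... | yes x∈p | yes x∈q = 𝟙-yes (x ∈? p ∩ q) (x∈p∩q⁺ (x∈p , x∈q))
  ... | yes _   | no x∉q  = 𝟙-no (x ∈? p ∩ q) (x∉q ∘ p∩q⊆q p q)
  ... | no x∉p  | yes _   = 𝟙-no (x ∈? p ∩ q) (x∉p ∘ p∩q⊆p p q)
  ... | no x∉p  | no _    = 𝟙-no (x ∈? p ∩ q) (x∉p ∘ p∩q⊆p p q)

∑∈≤term+rest : (p : Subset n) {f : Fin n → ℕ} {k : ℕ} {w : Fin n} → w ∈ p → (∀ x → f x ≤ k) →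
               ∑∈ p f ≤ f w + k * ∣ p - w ∣
∑∈≤term+rest p {f} {k} {w} w∈p f≤k = begin
  ∑∈ p f                                                   ≤⟨ sum-mono pointwise ⟩
  sum (λ x → 𝟙 (x ∈? ⁅ w ⁆) * f w + 𝟙 (x ∈? p - w) * k)    ≡⟨ ∑-distrib-+ (λ x → 𝟙 (x ∈? ⁅ w ⁆) * f w) (λ x → 𝟙 (x ∈? p - w) * k) ⟩
  ∑∈ ⁅ w ⁆ (λ _ → f w) + ∑∈ (p - w) (λ _ → k)              ≡⟨ cong₂ _+_ (∑∈-const ⁅ w ⁆ (f w)) (∑∈-const (p - w) k) ⟩
  f w * ∣ ⁅ w ⁆ ∣ + k * ∣ p - w ∣                          ≡⟨ cong (λ z → f w * z + k * ∣ p - w ∣) (∣⁅x⁆∣≡1 w) ⟩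
  f w * 1 + k * ∣ p - w ∣                                  ≡⟨ cong (_+ k * ∣ p - w ∣) (*-identityʳ (f w)) ⟩
  f w + k * ∣ p - w ∣                                      ∎
  where
  open ≤-Reasoning
  pointwise : ∀ x → 𝟙 (x ∈? p) * f x ≤ 𝟙 (x ∈? ⁅ w ⁆) * f w + 𝟙 (x ∈? p - w) * k
  pointwise x with x ∈? p
  ... | no _ = z≤n
  ... | yes x∈p with x ≟ w
  ...   | yes refl rewrite 𝟙-yes (x ∈? ⁅ x ⁆) (x∈⁅x⁆ x) = m≤m+n _ _
  ...   | no x≢w rewrite 𝟙-yes (x ∈? p - w) (x∈p∧x≢y⇒x∈p-y x∈p x≢w) =
          m≤n⇒m≤o+n (𝟙 (x ∈? ⁅ w ⁆) * f w) (+-monoˡ-≤ 0 (f≤k x))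

markov : (f : Fin n → ℕ) (k : ℕ) → k * ∣ select (λ x → k ≤? f x) ∣ ≤ sum f
markov f k = begin
  k * ∣ p ∣         ≡⟨ ∑∈-const p k ⟨
  ∑∈ p (λ _ → k)    ≤⟨ sum-mono pointwise ⟩
  sum f             ∎
  where
  open ≤-Reasoning
  p = select (λ x → k ≤? f x)
  pointwise : ∀ x → 𝟙 (x ∈? p) * k ≤ f x
  pointwise x with x ∈? p
  ... | yes x∈ = ≤-trans (≤-reflexive (+-identityʳ k)) (∈-select⁻ (λ x → k ≤? f x) x∈)
  ... | no _   = z≤n

module _ {a ℓ} {A : Set a} {P : Pred A ℓ} (P? : Decidable₁ P) where

  length-filter-tabulate : (f : Fin n → A) →
    length (filter P? (List.tabulate f)) ≡ sum (λ i → 𝟙 (P? (f i)))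
  length-filter-tabulate {zero}  f = refl
  length-filter-tabulate {suc n} f with does (P? (f zero))
  ... | true  = cong suc (length-filter-tabulate (f ∘ suc))
  ... | false = length-filter-tabulate (f ∘ suc)

deg≡sum : (G : Graph n) (v : Fin n) → deg G v ≡ sum (λ w → 𝟙 (Adj? G v w))
deg≡sum G v = length-filter-tabulate (Adj? G v) id

deg≤∣p∣ : (G : Graph n) {v : Fin n} (p : Subset n) → (∀ {w} → Adj G v w → w ∈ p) →
          deg G v ≤ ∣ p ∣
deg≤∣p∣ G {v} p N⊆p = begin
  deg G v                       ≡⟨ deg≡sum G v ⟩
  sum (λ w → 𝟙 (Adj? G v w))    ≤⟨ sum-mono (λ w → 𝟙-mono (Adj? G v w) (w ∈? p) N⊆p) ⟩
  sum (λ w → 𝟙 (w ∈? p))        ≡⟨ ∣p∣≡sum p ⟨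
  ∣ p ∣                         ∎
  where open ≤-Reasoning

∣p∣≤deg : (G : Graph n) {v : Fin n} (p : Subset n) → (∀ {w} → w ∈ p → Adj G v w) →
          ∣ p ∣ ≤ deg G v
∣p∣≤deg G {v} p p⊆N = begin
  ∣ p ∣                         ≡⟨ ∣p∣≡sum p ⟩
  sum (λ w → 𝟙 (w ∈? p))        ≤⟨ sum-mono (λ w → 𝟙-mono (w ∈? p) (Adj? G v w) p⊆N) ⟩
  sum (λ w → 𝟙 (Adj? G v w))    ≡⟨ deg≡sum G v ⟨
  deg G v                       ∎
  where open ≤-Reasoning

∣E∣≡sum : (G : Graph n) →
          ∣E∣ G ≡ sum (λ u → sum (λ v → 𝟙 ((u Fin.<? v) ×-dec Adj? G u v)))
∣E∣≡sum {n} G = go id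
  where
  P? : Decidable₁ _
  P? (u , v) = (u Fin.<? v) ×-dec Adj? G u v
  -- The induction peels off one row of the product at a time, so the first factor must be a
  -- tabulation of an arbitrary `f`; the claim is the case `id`.
  go : ∀ {m} (f : Fin m → Fin n) →
       length (filter P? (cartesianProduct (List.tabulate f) (allFin n))) ≡
       sum (λ i → sum (λ v → 𝟙 (P? (f i , v))))
  go {zero}  f = refl
  go {suc m} f = begin
    length (filter P? (row List.++ rest))                 ≡⟨ cong length (filter-++ P? row rest) ⟩
    length (filter P? row List.++ filter P? rest)         ≡⟨ length-++ (filter P? row) ⟩
    length (filter P? row) + length (filter P? rest)      ≡⟨ cong₂ _+_ row≡ (go (f ∘ suc)) ⟩
    sum (λ i → sum (λ v → 𝟙 (P? (f i , v))))              ∎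
    where
    open ≡-Reasoning
    row  = List.map (f zero ,_) (allFin n)
    rest = cartesianProduct (List.tabulate (f ∘ suc)) (allFin n)
    row≡ : length (filter P? row) ≡ sum (λ v → 𝟙 (P? (f zero , v)))
    row≡ = trans (cong (length ∘ filter P?) (map-tabulate id (f zero ,_)))
                 (length-filter-tabulate P? (f zero ,_))

-- Each arc is charged to its edge with the smaller endpoint first: descending arcs are transposed
-- by `∑-comm` and added to the ascending ones. By asymmetry no edge is charged twice.
∑∣out∣≤∣E∣ : (G : Graph n) (out : Fin n → Subset n) →
             (∀ {u v} → v ∈ out u → Adj G u v) →
             (∀ {u v} → v ∈ out u → u ∉ out v) →
             sum (∣_∣ ∘ out) ≤ ∣E∣ G
∑∣out∣≤∣E∣ {n} G out out⇒Adj asym = begin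
  sum (∣_∣ ∘ out)                                       ≡⟨ sum-cong-≗ (λ u → ∣p∣≡sum (out u)) ⟩
  sum (λ u → sum (λ v → c u v))                         ≤⟨ sum-mono (λ u → sum-mono (split u)) ⟩
  sum (λ u → sum (λ v → up u v * c u v + up v u * c u v))
    ≡⟨ sum-cong-≗ (λ u → ∑-distrib-+ (λ v → up u v * c u v) (λ v → up v u * c u v)) ⟩
  sum (λ u → sum (λ v → up u v * c u v) + sum (λ v → up v u * c u v))
    ≡⟨ ∑-distrib-+ (λ u → sum (λ v → up u v * c u v)) (λ u → sum (λ v → up v u * c u v)) ⟩
  sum (λ u → sum (λ v → up u v * c u v)) + sum (λ u → sum (λ v → up v u * c u v))
    ≡⟨ cong (sum (λ u → sum (λ v → up u v * c u v)) +_) (∑-comm (λ u v → up v u * c u v)) ⟩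
  sum (λ u → sum (λ v → up u v * c u v)) + sum (λ u → sum (λ v → up u v * c v u))
    ≡⟨ ∑-distrib-+ (λ u → sum (λ v → up u v * c u v)) (λ u → sum (λ v → up u v * c v u)) ⟨
  sum (λ u → sum (λ v → up u v * c u v) + sum (λ v → up u v * c v u))
    ≡⟨ sum-cong-≗ (λ u → ∑-distrib-+ (λ v → up u v * c u v) (λ v → up u v * c v u)) ⟨
  sum (λ u → sum (λ v → up u v * c u v + up u v * c v u))
    ≤⟨ sum-mono (λ u → sum-mono (edge u)) ⟩
  sum (λ u → sum (λ v → 𝟙 ((u Fin.<? v) ×-dec Adj? G u v)))  ≡⟨ ∣E∣≡sum G ⟨
  ∣E∣ G                                                 ∎
  where
  open ≤-Reasoning
  c up : Fin n → Fin n → ℕ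
  c u v  = 𝟙 (v ∈? out u)
  up u v = 𝟙 (u Fin.<? v)
  split : ∀ u v → c u v ≤ up u v * c u v + up v u * c u v
  split u v with Fin.<-cmp u v
  ... | tri< u<v _ _ rewrite 𝟙-yes (u Fin.<? v) u<v | +-identityʳ (c u v) = m≤m+n _ _
  ... | tri> _ _ v<u rewrite 𝟙-yes (v Fin.<? u) v<u | +-identityʳ (c u v) = m≤n+m _ _
  ... | tri≈ _ refl _ with u ∈? out u
  ...   | yes u∈ = contradiction u∈ (asym u∈)
  ...   | no _   = z≤n
  edge′ : ∀ u v (d : Dec (u Fin.< v)) →
          𝟙 d * c u v + 𝟙 d * c v u ≤ 𝟙 (d ×-dec Adj? G u v)
  edge′ u v (no _)  = z≤n
  edge′ u v (yes _) with v ∈? out u | u ∈? out v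
  ... | yes v∈ | yes u∈ = contradiction u∈ (asym v∈)
  ... | yes v∈ | no _   = ≤-reflexive (sym (𝟙-yes (Adj? G u v) (out⇒Adj v∈)))
  ... | no _   | yes u∈ = ≤-reflexive (sym (𝟙-yes (Adj? G u v) (Adj-sym G (out⇒Adj u∈))))
  ... | no _   | no _   = z≤n
  edge : ∀ u v → up u v * c u v + up u v * c v u ≤ 𝟙 ((u Fin.<? v) ×-dec Adj? G u v)
  edge u v = edge′ u v (u Fin.<? v)

-- Orientations

-- The sets `L j` increase, and each strict growth adds an element, which happens at most `n` times.
-- The invariant `n ≤ fuel + ∣ L j ∣` turns this into a recursion on `fuel`.
stabilises : ∀ {ℓ} (P : ℕ → Pred (Fin n) ℓ) → (∀ j → Decidable₁ (P j)) →
             (∀ j {x} → P j x → P (suc j) x) → ∃[ j ] (∀ {x} → P (suc j) x → P j x)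
stabilises {n} P P? P-mono = go n 0 (m≤m+n n _)
  where
  L : ℕ → Subset n
  L j = select (P? j)
  grows : ∀ j {x} → P (suc j) x → ¬ P j x → ∣ L j ∣ < ∣ L (suc j) ∣
  grows j {x} px ¬px = p⊂q⇒∣p∣<∣q∣
    ( ∈-select⁺ (P? (suc j)) ∘ P-mono j ∘ ∈-select⁻ (P? j)
    , x , ∈-select⁺ (P? (suc j)) px , ¬px ∘ ∈-select⁻ (P? j))
  go : ∀ fuel j → n ≤ fuel + ∣ L j ∣ → ∃[ j ] (∀ {x} → P (suc j) x → P j x)
  go fuel j n≤ with any? (λ x → P? (suc j) x ×-dec ¬? (P? j x))
  go fuel j n≤ | no ∄x = j , stable
    where
    stable : ∀ {x} → P (suc j) x → P j x
    stable {x} px with P? j x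
    ... | yes pjx = pjx
    ... | no ¬pjx = contradiction (x , px , ¬pjx) ∄x
  go zero j n≤ | yes (x , px , ¬px) =
    contradiction (≤-<-trans n≤ (grows j px ¬px)) (≤⇒≯ (∣p∣≤n (L (suc j))))
  go (suc fuel) j n≤ | yes (x , px , ¬px) = go fuel (suc j)
    (≤-trans n≤ (≤-trans (≤-reflexive (sym (+-suc fuel _))) (+-monoʳ-≤ fuel (grows j px ¬px))))

-- Some edges may remain unoriented, since orientations are built up edge by edge; `Covered` tells
-- which edges are already oriented.
record Suborientation (G : Graph n) : Set where
  field
    out     : Fin n → Subset n
    out⇒Adj : ∀ {u v} → v ∈ out u → Adj G u v
    asym    : ∀ {u v} → v ∈ out u → u ∉ out v

module _ {G : Graph n} where

  open Suborientation

  Covered : Suborientation G → Rel (Fin n) 0ℓ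
  Covered o u v = v ∈ out o u ⊎ u ∈ out o v

  Bounded : ℕ → Suborientation G → Set
  Bounded k o = ∀ u → ∣ out o u ∣ ≤ k

  module _ (o : Suborientation G) {x y : Fin n} (xy : Adj G x y) (new : ¬ Covered o x y)
           {p : Subset n} (p⊆out : p ⊆ out o x) where

    private
      out′ : Fin n → Subset n
      out′ = updateAt (out o) x (λ _ → p ∪ ⁅ y ⁆)

      out′⇒new⊎out : ∀ {u v} → v ∈ out′ u → (u ≡ x × v ≡ y) ⊎ v ∈ out o u
      out′⇒new⊎out {u} v∈ with u ≟ x
      ... | no u≢x = inj₂ (subst (_ ∈_) (updateAt-minimal u x (out o) u≢x) v∈)
      ... | yes refl with x∈p∪q⁻ p ⁅ y ⁆ (subst (_ ∈_) (updateAt-updates x (out o)) v∈)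
      ...   | inj₁ v∈p = inj₂ (p⊆out v∈p)
      ...   | inj₂ v∈y = inj₁ (refl , x∈⁅y⁆⇒x≡y y v∈y)

    -- Serves two purposes: `p = out o x` adds the arc from `x` to `y`, while `p = out o x - z`
    -- trades the arc to `z` for it, which respects the outdegree bound even if `x` is full.
    redirect : Suborientation G
    redirect .out = out′
    redirect .out⇒Adj v∈ with out′⇒new⊎out v∈
    ... | inj₁ (refl , refl) = xy
    ... | inj₂ v∈out         = out⇒Adj o v∈out
    redirect .asym v∈ u∈ with out′⇒new⊎out v∈ | out′⇒new⊎out u∈
    ... | inj₁ (refl , refl) | inj₁ (refl , _)    = Adj-irrefl G refl xy
    ... | inj₁ (refl , refl) | inj₂ u∈out         = new (inj₂ u∈out)
    ... | inj₂ v∈out         | inj₁ (refl , refl) = new (inj₂ v∈out)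
    ... | inj₂ v∈out         | inj₂ u∈out         = asym o v∈out u∈out

    redirect-at : out redirect x ≡ p ∪ ⁅ y ⁆
    redirect-at = updateAt-updates x (out o)

    redirect-away : ∀ {u} → u ≢ x → out redirect u ≡ out o u
    redirect-away {u} u≢x = updateAt-minimal u x (out o) u≢x

    redirect-bounded : ∀ {k} → ∣ p ∣ < k → Bounded k o → Bounded k redirect
    redirect-bounded {k} ∣p∣<k bounded u with u ≟ x
    ... | no u≢x   = subst (λ q → ∣ q ∣ ≤ k) (sym (redirect-away u≢x)) (bounded u)
    ... | yes refl = subst (λ q → ∣ q ∣ ≤ k) (sym redirect-at) (begin
      ∣ p ∪ ⁅ y ⁆ ∣        ≤⟨ ∣p∪q∣≤∣p∣+∣q∣ p ⁅ y ⁆ ⟩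
      ∣ p ∣ + ∣ ⁅ y ⁆ ∣    ≡⟨ cong (∣ p ∣ +_) (∣⁅x⁆∣≡1 y) ⟩
      ∣ p ∣ + 1            ≡⟨ +-comm ∣ p ∣ 1 ⟩
      suc ∣ p ∣            ≤⟨ ∣p∣<k ⟩
      k                    ∎)
      where open ≤-Reasoning

    redirect-new : y ∈ out redirect x
    redirect-new = subst (y ∈_) (sym redirect-at) (q⊆p∪q p ⁅ y ⁆ (x∈⁅x⁆ y))

    redirect-old : ∀ {u v} → v ∈ out o u → (u ≡ x → v ∈ p) → v ∈ out redirect u
    redirect-old {u} v∈ kept with u ≟ x
    ... | no u≢x   = subst (_ ∈_) (sym (redirect-away u≢x)) v∈
    ... | yes refl = subst (_ ∈_) (sym redirect-at) (p⊆p∪q ⁅ y ⁆ (kept refl))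

  -- The augmenting paths of the orientation: at most `j` arcs, leading to a vertex with a free
  -- place.
  Reach : ℕ → (Fin n → Subset n) → ℕ → Pred (Fin n) 0ℓ
  Reach k out zero    x = ∣ out x ∣ < k
  Reach k out (suc j) x = Reach k out j x ⊎ ∃[ z ] z ∈ out x × Reach k out j z

  Reach? : ∀ k out j → Decidable₁ (Reach k out j)
  Reach? k out zero    x = ∣ out x ∣ <? k
  Reach? k out (suc j) x = Reach? k out j x ⊎-dec any? (λ z → (z ∈? out x) ×-dec Reach? k out j z)

  -- An augmenting path passes only through vertices that reach a free place themselves, so the
  -- out-sets of all others may change.
  Reach-cong : ∀ {k out out′} j → (∀ {u} → Reach k out j u → out′ u ≡ out u) →
               ∀ {x} → Reach k out j x → Reach k out′ j x
  Reach-cong {k} zero    same r = subst (λ p → ∣ p ∣ < k) (sym (same r)) r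
  Reach-cong     (suc j) same (inj₁ r) = inj₁ (Reach-cong j (same ∘ inj₁) r)
  Reach-cong     (suc j) same {x} r@(inj₂ (z , z∈ , rz)) =
    inj₂ (z , subst (z ∈_) (sym (same r)) z∈ , Reach-cong j (same ∘ inj₁) rz)

  -- The edge xy displaces the first edge xz of a shortest path from x to a vertex with a
  -- free place, and zx is then inserted at z, which is closer to that vertex.
  insert : ∀ {k} j (o : Suborientation G) → Bounded k o → ∀ {x y} → Adj G x y →
           ¬ Covered o x y → Reach k (out o) j x →
           Σ[ o′ ∈ Suborientation G ] Bounded k o′ ×
             (∀ {u v} → Covered o u v → Covered o′ u v) × Covered o′ x y
  insert zero o bounded xy new free =
    redirect o xy new id , redirect-bounded o xy new id free bounded ,
    Sum.map old old , inj₁ (redirect-new o xy new id)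
    where
    old : ∀ {u v} → v ∈ out o u → v ∈ out (redirect o xy new id) u
    old v∈ = redirect-old o xy new id v∈ (λ { refl → v∈ })
  insert (suc j) o bounded xy new (inj₁ r) = insert j o bounded xy new r
  insert {k} (suc j) o bounded {x} {y} xy new (inj₂ (z , z∈ , rz)) with Reach? k (out o) j x
  ... | yes r = insert j o bounded xy new r
  ... | no ¬r = result
    where
    p = out o x - z

    p⊆out : p ⊆ out o x
    p⊆out = p─q⊆p (out o x) ⁅ z ⁆

    o₁ : Suborientation G
    o₁ = redirect o xy new p⊆out

    bounded₁ : Bounded k o₁
    bounded₁ = redirect-bounded o xy new p⊆out (<-≤-trans (x∈p⇒∣p-x∣<∣p∣ z∈) (bounded x)) bounded

    z≢x : z ≢ x
    z≢x refl = Adj-irrefl G refl (out⇒Adj o z∈)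

    new₁ : ¬ Covered o₁ z x
    new₁ (inj₁ x∈) = asym o z∈ (subst (x ∈_) (redirect-away o xy new p⊆out z≢x) x∈)
    new₁ (inj₂ z∈′) with x∈p∪q⁻ p ⁅ y ⁆ (subst (z ∈_) (redirect-at o xy new p⊆out) z∈′)
    ... | inj₁ z∈p = x∉p-x z (out o x) z∈p
    ... | inj₂ z∈y = new (inj₁ (subst (_∈ out o x) (x∈⁅y⁆⇒x≡y y z∈y) z∈))

    -- Since `x` does not reach a free place within `j` arcs, the path from `z` avoids `x`, the only
    -- vertex whose out-set has changed.
    rz₁ : Reach k (out o₁) j z
    rz₁ = Reach-cong j (λ r → redirect-away o xy new p⊆out (λ { refl → ¬r r })) rz

    result : Σ[ o′ ∈ Suborientation G ] Bounded k o′ ×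
               (∀ {u v} → Covered o u v → Covered o′ u v) × Covered o′ x y
    result with insert j o₁ bounded₁ (Adj-sym G (out⇒Adj o z∈)) new₁ rz₁
    ... | o′ , bounded′ , old′ , new′ =
      o′ , bounded′ , [ old , Sum.swap ∘ old ]′ , old′ (inj₁ (redirect-new o xy new p⊆out))
      where
      old : ∀ {u v} → v ∈ out o u → Covered o′ u v
      old {u} {v} v∈ with u ≟ x | v ≟ z
      -- This is the displaced arc; the recursive call has covered its edge again.
      ... | yes refl | yes refl = Sum.swap new′
      ... | no u≢x   | _        = old′ (inj₁ (redirect-old o xy new p⊆out v∈ (λ u≡x → contradiction u≡x u≢x)))
      ... | yes refl | no v≢z   = old′ (inj₁ (redirect-old o xy new p⊆out v∈ (λ _ → x∈p∧x≢y⇒x∈p-y v∈ v≢z)))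

  -- If all vertices of U have their k places taken by edges inside U, then these
  -- edges together with xy are too many.
  overfull : ∀ {k} → (∀ (H : Graph n) → H ⊆ᴳ G → Nonempty (V H) → ∣E∣ H ≤ k * ∣V∣ H) →
             (o : Suborientation G) (U : Subset n) →
             (∀ {u} → u ∈ U → k ≤ ∣ out o u ∣) → (∀ {u} → u ∈ U → out o u ⊆ U) →
             ∀ {x y} → Adj G x y → x ∈ U → y ∈ U → Covered o x y
  overfull {k} sparse o U full closed {x} {y} xy x∈U y∈U with (y ∈? out o x) ⊎-dec (x ∈? out o y)
  ... | yes covered = covered
  ... | no new = contradiction (sparse H H⊆G (x , x∈p∩q⁺ (x∈U , Adj⇒∈V G xy))) (<⇒≱ (begin-strict
    k * ∣ U ∩ V G ∣                      ≤⟨ *-monoʳ-≤ k (∣p∩q∣≤∣p∣ U (V G)) ⟩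
    k * ∣ U ∣                            ≡⟨ ∑∈-const U k ⟨
    sum (λ u → 𝟙 (u ∈? U) * k)           <⟨ sum-mono-< k≤out′ x k<out′ ⟩
    sum (∣_∣ ∘ outᵁ)                     ≤⟨ ∑∣out∣≤∣E∣ H outᵁ outᵁ⇒Adj outᵁ-asym ⟩
    ∣E∣ H                                ∎))
    where
    open ≤-Reasoning
    -- `o⁺` may exceed the outdegree bound at `x`. Exactly this surplus arc makes the edge count
    -- strict.
    o⁺ : Suborientation G
    o⁺ = redirect o xy new id

    -- The subgraph induced on `U`. Elements of `U` outside `V G` are dropped, which can only lower
    -- the allowed number of edges.
    H : Graph n
    H = record
      { V          = U ∩ V G
      ; Adj        = λ u v → Adj G u v × u ∈ U × v ∈ U
      ; Adj?       = λ u v → Adj? G u v ×-dec (u ∈? U) ×-dec (v ∈? U)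
      ; Adj-sym    = λ (uv , u∈ , v∈) → Adj-sym G uv , v∈ , u∈
      ; Adj-irrefl = λ u≡v (uv , _) → Adj-irrefl G u≡v uv
      ; Adj⇒∈V     = λ (uv , u∈ , _) → x∈p∩q⁺ (u∈ , Adj⇒∈V G uv)
      }

    H⊆G : H ⊆ᴳ G
    H⊆G = record { V⊆ = p∩q⊆q U (V G) ; Adj⊆ = proj₁ }

    outᵁ : Fin n → Subset n
    outᵁ u = if does (u ∈? U) then out o⁺ u else ⊥

    outᵁ⇒ : ∀ {u v} → v ∈ outᵁ u → u ∈ U × v ∈ out o⁺ u
    outᵁ⇒ {u} v∈ with u ∈? U
    ... | yes u∈ = u∈ , v∈
    ... | no _   = contradiction v∈ ∉⊥

    closed⁺ : ∀ {u v} → u ∈ U → v ∈ out o⁺ u → v ∈ U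
    closed⁺ {u} {v} u∈ v∈ with u ≟ x
    ... | no u≢x = closed u∈ (subst (v ∈_) (redirect-away o xy new id u≢x) v∈)
    ... | yes refl with x∈p∪q⁻ (out o x) ⁅ y ⁆ (subst (v ∈_) (redirect-at o xy new id) v∈)
    ...   | inj₁ v∈out = closed u∈ v∈out
    ...   | inj₂ v∈y   = subst (_∈ U) (sym (x∈⁅y⁆⇒x≡y y v∈y)) y∈U

    outᵁ⇒Adj : ∀ {u v} → v ∈ outᵁ u → Adj H u v
    outᵁ⇒Adj v∈ with outᵁ⇒ v∈
    ... | u∈U , v∈out = out⇒Adj o⁺ v∈out , u∈U , closed⁺ u∈U v∈out

    outᵁ-asym : ∀ {u v} → v ∈ outᵁ u → u ∉ outᵁ v
    outᵁ-asym v∈ u∈ = asym o⁺ (proj₂ (outᵁ⇒ v∈)) (proj₂ (outᵁ⇒ u∈))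

    k<∣out⁺x∣ : k < ∣ out o⁺ x ∣
    k<∣out⁺x∣ = begin-strict
      k                        ≤⟨ full x∈U ⟩
      ∣ out o x ∣              <⟨ p⊂q⇒∣p∣<∣q∣ (p⊆p∪q ⁅ y ⁆ , y , q⊆p∪q (out o x) ⁅ y ⁆ (x∈⁅x⁆ y) , new ∘ inj₁) ⟩
      ∣ out o x ∪ ⁅ y ⁆ ∣      ≡⟨ cong ∣_∣ (redirect-at o xy new id) ⟨
      ∣ out o⁺ x ∣             ∎

    k<out′ : 𝟙 (x ∈? U) * k < ∣ outᵁ x ∣
    k<out′ with x ∈? U
    ... | yes _ = ≤-<-trans (≤-reflexive (*-identityˡ k)) k<∣out⁺x∣
    ... | no x∉ = contradiction x∈U x∉

    k≤out′ : ∀ u → 𝟙 (u ∈? U) * k ≤ ∣ outᵁ u ∣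
    k≤out′ u with u ∈? U
    ... | no _ = z≤n
    ... | yes u∈ with u ≟ x
    ...   | yes refl = ≤-trans (≤-reflexive (*-identityˡ k)) (<⇒≤ k<∣out⁺x∣)
    ...   | no u≢x   = begin
      1 * k            ≡⟨ *-identityˡ k ⟩
      k                ≤⟨ full u∈ ⟩
      ∣ out o u ∣      ≡⟨ cong ∣_∣ (redirect-away o xy new id u≢x) ⟨
      ∣ out o⁺ u ∣     ∎

  -- Hakimi's theorem.
  orientation : ∀ {k} → (∀ (H : Graph n) → H ⊆ᴳ G → Nonempty (V H) → ∣E∣ H ≤ k * ∣V∣ H) →
                Σ[ o ∈ Suborientation G ] Bounded k o × (∀ {u v} → Adj G u v → Covered o u v)
  orientation {k} sparse with cover (cartesianProduct (allFin n) (allFin n))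
    where
    step : ∀ (o : Suborientation G) → Bounded k o → ∀ x y →
           Σ[ o′ ∈ Suborientation G ] Bounded k o′ ×
             (∀ {u v} → Covered o u v → Covered o′ u v) × (Adj G x y → Covered o′ x y)
    step o bounded x y with Adj? G x y | (y ∈? out o x) ⊎-dec (x ∈? out o y)
    ... | no ¬xy | _           = o , bounded , id , λ xy → contradiction xy ¬xy
    ... | yes _  | yes covered = o , bounded , id , λ _ → covered
    ... | yes xy | no new
      -- Paths longer than this `j` reach nothing new, so a vertex that fails `Reach` at `j` reaches
      -- no free place at all.
      with stabilises (Reach k (out o)) (Reach? k (out o)) (λ _ → inj₁)
    ...   | j , stable with Reach? k (out o) j x | Reach? k (out o) j y
    ...     | yes rx | _ with insert j o bounded xy new rx
    ...       | o′ , bounded′ , old , covered = o′ , bounded′ , old , λ _ → covered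
    step o bounded x y | yes xy | no new | j , stable | _ | yes ry
      with insert j o bounded (Adj-sym G xy) (new ∘ Sum.swap) ry
    ...       | o′ , bounded′ , old , covered = o′ , bounded′ , old , λ _ → Sum.swap covered
    -- The vertices that reach no free place have all `k` places taken and send arcs only to one
    -- another, so they form a set to which `overfull` applies.
    step o bounded x y | yes xy | no new | j , stable | no ¬rx | no ¬ry =
      contradiction (overfull sparse o U full closed xy (∈-select⁺ stuck? ¬rx) (∈-select⁺ stuck? ¬ry)) new
      where
      stuck? : Decidable₁ (λ u → ¬ Reach k (out o) j u)
      stuck? u = ¬? (Reach? k (out o) j u)
      U = select stuck?
      Reach-zero : ∀ j {u} → Reach k (out o) 0 u → Reach k (out o) j u
      Reach-zero zero    = id
      Reach-zero (suc j) = inj₁ ∘ Reach-zero j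
      full : ∀ {u} → u ∈ U → k ≤ ∣ out o u ∣
      full u∈ = ≮⇒≥ (∈-select⁻ stuck? u∈ ∘ Reach-zero j)
      closed : ∀ {u} → u ∈ U → out o u ⊆ U
      closed u∈ z∈ = ∈-select⁺ stuck? (λ rz → ∈-select⁻ stuck? u∈ (stable (inj₂ (_ , z∈ , rz))))

    cover : ∀ es → Σ[ o ∈ Suborientation G ] Bounded k o ×
              All (λ (u , v) → Adj G u v → Covered o u v) es
    cover [] = record { out     = λ _ → ⊥
                      ; out⇒Adj = λ v∈ → contradiction v∈ ∉⊥
                      ; asym    = λ v∈ → contradiction v∈ ∉⊥ } ,
               (λ _ → ≤-trans (≤-reflexive (∣⊥∣≡0 n)) z≤n) , []
    cover ((x , y) ∷ es) with cover es
    ... | o , bounded , all with step o bounded x y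
    ...   | o′ , bounded′ , old , covered = o′ , bounded′ , covered ∷ All.map (old ∘_) all
  ... | o , bounded , all =
    o , bounded , All.lookup all (∈-cartesianProduct⁺ (∈-allFin _) (∈-allFin _))

-- Maximum degree, maximum average degree and degeneracy

Δ≤⇒deg≤ : ∀ (G : Graph n) {D} → Δ G ≤ D → ∀ v → deg G v ≤ D
Δ≤⇒deg≤ {n} G Δ≤D v = ≤-trans
  (All.lookup (All.map⁻ (Extrema.xs≤max 0 (List.map (deg G) (allFin n)))) (∈-allFin v)) Δ≤D

deg≤⇒Δ≤ : ∀ (G : Graph n) {D} → (∀ v → deg G v ≤ D) → Δ G ≤ D
deg≤⇒Δ≤ {n} G deg≤D = Extrema.max≤v⁺ z≤n (All.map⁺ (All.universal deg≤D (allFin n)))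

/<⇒<* : ∀ a b c .{{_ : NonZero b}} → ℤ.+ a ℚ./ b ℚ.< ℤ.+ c ℚ./ 1 → a < c * b
/<⇒<* a (suc d) c a/b<c with
  ℚᵘ.<-respˡ-≃ (ℚ.toℚᵘ-fromℚᵘ (ℚᵘ.mkℚᵘ (ℤ.+ a) d))
    (ℚᵘ.<-respʳ-≃ (ℚ.toℚᵘ-fromℚᵘ (ℚᵘ.mkℚᵘ (ℤ.+ c) 0)) (ℚ.toℚᵘ-mono-< a/b<c))
... | ℚᵘ.*<* a*1<c*b = ℤ.drop‿+<+
  (subst₂ ℤ._<_ (ℤ.*-identityʳ (ℤ.+ a)) (sym (ℤ.pos-* c (suc d))) a*1<c*b)

-- The average degree of `H` is at most mad, hence below 4. So `2 * ∣E∣ H < 4 * ∣V∣ H`, and halving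
-- gives the hypothesis of Hakimi's theorem for `k = 2`.
mad<4⇒sparse : (G : Graph n) → Mad< G (ℤ.+ 4 ℚ./ 1) →
               ∀ (H : Graph n) → H ⊆ᴳ G → Nonempty (V H) → ∣E∣ H ≤ 2 * ∣V∣ H
mad<4⇒sparse G (m , (_ , m-max) , m<4) H H⊆G (x , x∈) =
  *-cancelˡ-≤ 2 (<⇒≤ (subst (2 * ∣E∣ H <_) (*-assoc 2 2 (∣V∣ H))
    (/<⇒<* (2 * ∣E∣ H) (∣V∣ H) 4 (ℚ.≤-<-trans (m-max (H , H⊆G , nonZero , refl)) m<4))))
  where
  instance
    nonZero : NonZero (∣V∣ H)
    nonZero = >-nonZero (≤-trans (≤-reflexive (sym (∣⁅x⁆∣≡1 x)))
      (p⊆q⇒∣p∣≤∣q∣ (λ y∈ → subst (_∈ V H) (sym (x∈⁅y⁆⇒x≡y x y∈)) x∈)))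


-- In a subgraph, a vertex of maximal rank has no neighbour of larger rank, so all its neighbours
-- are among its at most `k` parents.
rank⇒degenerate : (G : Graph n) {k : ℕ} (rank : Fin n → ℕ) (parents : Fin n → Subset n) →
                  (∀ v → ∣ parents v ∣ ≤ k) →
                  (∀ {v w} → Adj G v w → rank w ≤ rank v → w ∈ parents v) →
                  Degenerate k G
rank⇒degenerate {n} G rank parents ∣parents∣≤k lower H H⊆G (x , x∈) =
  top , top∈ , ≤-trans (deg≤∣p∣ H (parents top) N⊆parents) (∣parents∣≤k top)
  where
  vs : List (Fin n)
  vs = filter (_∈? V H) (allFin n)
  top : Fin n
  -- The default `x` is a vertex of `H`, so `top` is one in every case.
  top = Extrema.argmax rank x vs
  top∈ : top ∈ V H
  top∈ = Extrema.argmax-all rank x∈ (All.all-filter (_∈? V H) (allFin n))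
  N⊆parents : ∀ {w} → Adj H top w → w ∈ parents top
  N⊆parents {w} vw = lower (_⊆ᴳ_.Adj⊆ H⊆G vw)
    (All.lookup (Extrema.f[xs]≤f[argmax] x vs)
      (∈-filter⁺ (_∈? V H) (∈-allFin w) (Adj⇒∈V H (Adj-sym H vw))))

-- The 2-degenerate subgraph obtained from a large clique

module Reduction (G : Graph n) (o : Suborientation G) (bounded : Bounded 2 o)
         (covers : ∀ {u v} → Adj G u v → Covered o u v)
         {D : ℕ} (deg≤D : ∀ v → deg G v ≤ D)
         {S : Subset n} (S-clique : IsClique (G ²) S) where

  open Suborientation o

  inn : Fin n → Subset n
  inn u = select (λ v → u ∈? out v)

  inn⁺ : ∀ {u v} → v ∈ out u → u ∈ inn v
  inn⁺ {v = v} = ∈-select⁺ (λ w → v ∈? out w)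

  inn⁻ : ∀ {u v} → u ∈ inn v → v ∈ out u
  inn⁻ {v = v} = ∈-select⁻ (λ w → v ∈? out w)

  ∣inn∣≤D : ∀ u → ∣ inn u ∣ ≤ D
  ∣inn∣≤D u = ≤-trans (∣p∣≤deg G (inn u) (λ w∈ → Adj-sym G (out⇒Adj (inn⁻ w∈)))) (deg≤D u)

  h : Fin n → ℕ
  h w = ∣ S ∩ inn w ∣

  h≤D : ∀ w → h w ≤ D
  h≤D w = ≤-trans (∣p∩q∣≤∣q∣ S (inn w)) (∣inn∣≤D w)

  -- The number of directed walks of length one or two from `N` to `u`. `N` is a parameter because
  -- both `S` and `Light` are used for it.
  walks : Subset n → Fin n → ℕ
  walks N u = ∣ N ∩ inn u ∣ + ∑∈ (inn u) (λ w → ∣ N ∩ inn w ∣)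

  -- Double counting: every `w` passes `f w` to each of its at most two out-neighbours.
  sum-∑∈-inn : (f : Fin n → ℕ) → sum (λ u → ∑∈ (inn u) f) ≤ 2 * sum f
  sum-∑∈-inn f = begin
    sum (λ u → sum (λ w → 𝟙 (w ∈? inn u) * f w))
      ≡⟨ ∑-comm (λ u w → 𝟙 (w ∈? inn u) * f w) ⟩
    sum (λ w → sum (λ u → 𝟙 (w ∈? inn u) * f w))
      ≤⟨ sum-mono (λ w → sum-mono (λ u → *-monoˡ-≤ (f w) (𝟙-mono (w ∈? inn u) (u ∈? out w) inn⁻))) ⟩
    sum (λ w → ∑∈ (out w) (λ _ → f w))
      ≡⟨ sum-cong-≗ (λ w → ∑∈-const (out w) (f w)) ⟩
    sum (λ w → f w * ∣ out w ∣)
      ≤⟨ sum-mono (λ w → ≤-trans (*-monoʳ-≤ (f w) (bounded w)) (≤-reflexive (*-comm (f w) 2))) ⟩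
    sum (λ w → 2 * f w)    ≡⟨ *-distribˡ-sum 2 f ⟨
    2 * sum f              ∎
    where open ≤-Reasoning

  sum-h : sum h ≤ 2 * ∣ S ∣
  sum-h = begin
    sum h                                       ≡⟨ sum-cong-≗ (λ w → ∣p∩q∣≡∑∈ S (inn w)) ⟩
    sum (λ w → ∑∈ (inn w) (λ v → 𝟙 (v ∈? S)))   ≤⟨ sum-∑∈-inn (λ v → 𝟙 (v ∈? S)) ⟩
    2 * sum (λ v → 𝟙 (v ∈? S))                  ≡⟨ cong (2 *_) (∣p∣≡sum S) ⟨
    2 * ∣ S ∣                                   ∎
    where open ≤-Reasoning

  sum-walks : sum (walks S) ≤ 6 * ∣ S ∣
  sum-walks = begin
    sum (walks S)                           ≡⟨ ∑-distrib-+ h (λ u → ∑∈ (inn u) h) ⟩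
    sum h + sum (λ u → ∑∈ (inn u) h)       ≤⟨ +-monoʳ-≤ (sum h) (sum-∑∈-inn h) ⟩
    -- One `sum h` counts the walks of length one, and `2 * sum h` bounds those of length two.
    3 * sum h                              ≤⟨ *-monoʳ-≤ 3 sum-h ⟩
    3 * (2 * ∣ S ∣)                        ≡⟨ *-assoc 3 2 ∣ S ∣ ⟨
    6 * ∣ S ∣                              ∎
    where open ≤-Reasoning

  -- Each `v` in `N` is within two steps of `u`, and the directions of the steps give seven cases:
  -- `v = u` (one vertex), `u → v` (at most 2), `v → u`, `u → w → v` (`A₁`, at most 4), `u → w ← v`
  -- (`A₂`), `u ← w → v` (`A₃`, at most `D`, as each `w` has at most one further out-neighbour) and
  -- `v → w → u` (`A₄`). The third and the last case make up `walks N u`. `A₂` is taken in all of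
  -- `S` so that `h` counts it; the walks start in `N` only, so that they can vanish for `Light`.
  ∣N∣≤ : ∀ {u} → u ∈ S → (N : Subset n) → N ⊆ S → ∣ N ∣ ≤ 7 + D + ∑∈ (out u) h + walks N u
  ∣N∣≤ {u} u∈S N N⊆S = begin
    ∣ N ∣
      ≤⟨ p⊆q⇒∣p∣≤∣q∣ N⊆ ⟩
    ∣ ⁅ u ⁆ ∪ (out u ∪ (N ∩ inn u ∪ (A₁ ∪ (A₂ ∪ (A₃ ∪ A₄))))) ∣
      ≤⟨ ∪≤ ⁅ u ⁆ (≤-reflexive (∣⁅x⁆∣≡1 u)) (∪≤ (out u) (bounded u) (∪≤ (N ∩ inn u) ≤-refl
           (∪≤ A₁ ∣A₁∣≤4 (∪≤ A₂ (∣⋃∈∣≤∑∈ (out u) (S ∩inn_)) (∪≤ A₃ ∣A₃∣≤D (∣⋃∈∣≤∑∈ (inn u) (N ∩inn_))))))) ⟩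
    1 + (2 + (∣ N ∩ inn u ∣ + (4 + (∑∈ (out u) h + (D + ∑∈ (inn u) (λ w → ∣ N ∩ inn w ∣))))))
      ≡⟨ solve 4 (λ i e d q → con 1 :+ (con 2 :+ (i :+ (con 4 :+ (e :+ (d :+ q))))) :=
                              con 7 :+ d :+ e :+ (i :+ q)) refl
           (∣ N ∩ inn u ∣) (∑∈ (out u) h) D (∑∈ (inn u) (λ w → ∣ N ∩ inn w ∣)) ⟩
    7 + D + ∑∈ (out u) h + walks N u    ∎
    where
    open ≤-Reasoning
    open +-*-Solver
    _∩inn_ : Subset n → Fin n → Subset n
    M ∩inn w = M ∩ inn w
    A₁ A₂ A₃ A₄ : Subset n
    A₁ = ⋃∈ (out u) out
    A₂ = ⋃∈ (out u) (S ∩inn_)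
    A₃ = ⋃∈ (inn u) (λ w → out w - u)
    A₄ = ⋃∈ (inn u) (N ∩inn_)

    ∪≤ : ∀ p {q : Subset n} {a b} → ∣ p ∣ ≤ a → ∣ q ∣ ≤ b → ∣ p ∪ q ∣ ≤ a + b
    ∪≤ p {q} ∣p∣≤a ∣q∣≤b = ≤-trans (∣p∪q∣≤∣p∣+∣q∣ p q) (+-mono-≤ ∣p∣≤a ∣q∣≤b)

    ∣A₁∣≤4 : ∣ A₁ ∣ ≤ 4
    ∣A₁∣≤4 = ≤-trans (∣⋃∈∣≤∑∈ (out u) out)
      (≤-trans (∑∈-bound (out u) 2 (λ {w} _ → bounded w)) (*-monoʳ-≤ 2 (bounded u)))

    ∣A₃∣≤D : ∣ A₃ ∣ ≤ D
    ∣A₃∣≤D = ≤-trans (∣⋃∈∣≤∑∈ (inn u) (λ w → out w - u))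
      (≤-trans (∑∈-bound (inn u) 1
                 (λ {w} w∈ → s≤s⁻¹ (<-≤-trans (x∈p⇒∣p-x∣<∣p∣ (inn⁻ w∈)) (bounded w))))
               (≤-trans (≤-reflexive (*-identityˡ _)) (∣inn∣≤D u)))

    at₁ : ∀ {v} → v ∈ out u → v ∈ ⁅ u ⁆ ∪ (out u ∪ (N ∩ inn u ∪ (A₁ ∪ (A₂ ∪ (A₃ ∪ A₄)))))
    at₁ = q⊆p∪q ⁅ u ⁆ _ ∘ p⊆p∪q _
    at₂ : ∀ {v} → v ∈ N ∩ inn u → v ∈ ⁅ u ⁆ ∪ (out u ∪ (N ∩ inn u ∪ (A₁ ∪ (A₂ ∪ (A₃ ∪ A₄)))))
    at₂ = q⊆p∪q ⁅ u ⁆ _ ∘ q⊆p∪q (out u) _ ∘ p⊆p∪q _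
    at₃ : ∀ {v} → v ∈ A₁ ∪ (A₂ ∪ (A₃ ∪ A₄)) → v ∈ ⁅ u ⁆ ∪ (out u ∪ (N ∩ inn u ∪ (A₁ ∪ (A₂ ∪ (A₃ ∪ A₄)))))
    at₃ = q⊆p∪q ⁅ u ⁆ _ ∘ q⊆p∪q (out u) _ ∘ q⊆p∪q (N ∩ inn u) _

    N⊆ : N ⊆ ⁅ u ⁆ ∪ (out u ∪ (N ∩ inn u ∪ (A₁ ∪ (A₂ ∪ (A₃ ∪ A₄)))))
    N⊆ {v} v∈N with v ≟ u
    ... | yes refl = p⊆p∪q _ (x∈⁅x⁆ v)
    ... | no v≢u with IsClique.adjacent S-clique u∈S (N⊆S v∈N) (v≢u ∘ sym)
    ...   | inj₁ uv = [ at₁ , (λ u∈ → at₂ (x∈p∩q⁺ (v∈N , inn⁺ u∈))) ]′ (covers uv)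
    ...   | inj₂ (_ , _ , w , uw , wv) with covers uw | covers wv
    ...     | inj₁ w∈ | inj₁ v∈ = at₃ (p⊆p∪q _ (∈-⋃∈⁺ (out u) out w∈ v∈))
    ...     | inj₁ w∈ | inj₂ w∈′ = at₃ (q⊆p∪q A₁ _ (p⊆p∪q _
              (∈-⋃∈⁺ (out u) (S ∩inn_) w∈ (x∈p∩q⁺ (N⊆S v∈N , inn⁺ w∈′)))))
    ...     | inj₂ u∈ | inj₁ v∈ = at₃ (q⊆p∪q A₁ _ (q⊆p∪q A₂ _ (p⊆p∪q _
              (∈-⋃∈⁺ (inn u) (λ w → out w - u) (inn⁺ u∈) (x∈p∧x≢y⇒x∈p-y v∈ v≢u)))))
    ...     | inj₂ u∈ | inj₂ w∈′ = at₃ (q⊆p∪q A₁ _ (q⊆p∪q A₂ _ (q⊆p∪q A₃ _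
              (∈-⋃∈⁺ (inn u) (N ∩inn_) (inn⁺ u∈) (x∈p∩q⁺ (v∈N , inn⁺ w∈′))))))

  -- Besides `w` there is at most one out-neighbour of `u`, and it contributes at most `D`. For
  -- large `N` and few walks this forces `h w` to be large.
  ∣N∣≤h+ : ∀ {u w} → u ∈ S → w ∈ out u → (N : Subset n) → N ⊆ S →
           ∣ N ∣ ≤ 7 + D + (h w + D) + walks N u
  ∣N∣≤h+ {u} {w} u∈S w∈ N N⊆S = ≤-trans (∣N∣≤ u∈S N N⊆S)
    (+-monoˡ-≤ (walks N u) (+-monoʳ-≤ (7 + D) (begin
      ∑∈ (out u) h                  ≤⟨ ∑∈≤term+rest (out u) w∈ h≤D ⟩
      h w + D * ∣ out u - w ∣       ≤⟨ +-monoʳ-≤ (h w) (*-monoʳ-≤ D (s≤s⁻¹ (<-≤-trans (x∈p⇒∣p-x∣<∣p∣ w∈) (bounded u)))) ⟩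
      h w + D * 1                   ≡⟨ cong (h w +_) (*-identityʳ D) ⟩
      h w + D                       ∎)))
    where open ≤-Reasoning

  hub? : Decidable₁ (λ w → ∣ S ∣ ≤ 10 * h w)
  hub? w = ∣ S ∣ ≤? 10 * h w

  Hubs : Subset n
  Hubs = select hub?

  heavy? : Decidable₁ (λ u → 60 ≤ walks S u)
  heavy? u = 60 ≤? walks S u

  light? : Decidable₁ (λ u → u ∈ S × ¬ 60 ≤ walks S u)
  light? u = (u ∈? S) ×-dec ¬? (heavy? u)

  Heavy Light : Subset n
  Heavy = select heavy?
  Light = select light?

  -- Markov's inequality: the threshold 60 is ten times the 6 in `sum-walks`.
  10∣Heavy∣≤∣S∣ : 10 * ∣ Heavy ∣ ≤ ∣ S ∣
  10∣Heavy∣≤∣S∣ = *-cancelˡ-≤ 6 (≤-trans (≤-reflexive (sym (*-assoc 6 10 ∣ Heavy ∣)))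
    (≤-trans (markov (walks S) 60) sum-walks))

  module _ (large : 5 * D + 165 ≤ 2 * ∣ S ∣) where

    -- Fewer than 60 walks and `N = S` leave `s ≤ 2 * D + 66 + h w`. By `large`, `2 * D + 66` is at
    -- most four fifths of `s`; the 165 comes from `5 * 66 = 2 * 165`. Hence even `s ≤ 5 * h w`.
    Light-out : ∀ {u} → u ∈ Light → out u ⊆ Hubs
    Light-out {u} u∈ {w} w∈ with ∈-select⁻ light? u∈
    ... | u∈S , ¬heavy = ∈-select⁺ hub? (+-cancelʳ-≤ (4 * s) s (10 * h w) (begin
      s + 4 * s                                   ≡⟨⟩
      5 * s                                       ≤⟨ *-monoʳ-≤ 5 (∣N∣≤h+ u∈S w∈ S id) ⟩
      5 * (7 + D + (h w + D) + walks S u)         ≤⟨ *-monoʳ-≤ 5 (+-monoʳ-≤ (7 + D + (h w + D)) (s≤s⁻¹ (≰⇒> ¬heavy))) ⟩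
      5 * (7 + D + (h w + D) + 59)                ≡⟨ solve 2 (λ d x → con 5 :* (con 7 :+ d :+ (x :+ d) :+ con 59) :=
                                                        con 5 :* x :+ con 2 :* (con 5 :* d :+ con 165)) refl D (h w) ⟩
      5 * h w + 2 * (5 * D + 165)                 ≤⟨ +-mono-≤ (*-monoˡ-≤ (h w) {5} {10} (≤ᵇ⇒≤ 5 10 _)) (*-monoʳ-≤ 2 large) ⟩
      10 * h w + 2 * (2 * s)                      ≡⟨ cong (10 * h w +_) (*-assoc 2 2 s) ⟨
      10 * h w + 4 * s                            ∎))
      where
      open ≤-Reasoning
      open +-*-Solver
      s = ∣ S ∣

    Exceptional : Subset n
    Exceptional = Hubs ∪ ⋃∈ Hubs out

    S′ : Subset n
    S′ = S ─ Exceptional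

    S′⊆S : S′ ⊆ S
    S′⊆S = p─q⊆p S Exceptional

    S′∉Hubs : ∀ {u} → u ∈ S′ → u ∉ Hubs
    S′∉Hubs u∈ u∈Hubs = x∈p─q⇒x∉q S Exceptional u∈ (p⊆p∪q (⋃∈ Hubs out) u∈Hubs)

    S′∉outHubs : ∀ {u w} → u ∈ S′ → w ∈ Hubs → u ∉ out w
    S′∉outHubs u∈ w∈ u∈out =
      x∈p─q⇒x∉q S Exceptional u∈ (q⊆p∪q Hubs (⋃∈ Hubs out) (∈-⋃∈⁺ Hubs out w∈ u∈out))

    -- The first arc of such a walk ends in a hub by `Light-out`, but a vertex of `S′` is neither a
    -- hub nor an out-neighbour of one.
    walks-Light : ∀ {u} → u ∈ S′ → walks Light u ≤ 0
    walks-Light {u} u∈ = +-mono-≤ direct (∑∈-bound (inn u) 0 indirect)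
      where
      empty : ∀ {p : Subset n} → (∀ {x} → x ∉ p) → ∣ p ∣ ≤ 0
      empty {p} ∉p = ≤-trans (p⊆q⇒∣p∣≤∣q∣ {q = ⊥} (λ x∈ → contradiction x∈ ∉p)) (≤-reflexive (∣⊥∣≡0 n))
      direct : ∣ Light ∩ inn u ∣ ≤ 0
      direct = empty (λ v∈ → let v∈Light , v∈inn = x∈p∩q⁻ Light (inn u) v∈ in
        S′∉Hubs u∈ (Light-out v∈Light (inn⁻ v∈inn)))
      indirect : ∀ {w} → w ∈ inn u → ∣ Light ∩ inn w ∣ ≤ 0
      indirect {w} w∈ = empty (λ v∈ → let v∈Light , v∈inn = x∈p∩q⁻ Light (inn w) v∈ in
        S′∉outHubs u∈ (Light-out v∈Light (inn⁻ v∈inn)) (inn⁻ w∈))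

    -- Light vertices have all out-neighbours in Hubs, so no short walk from Light ends in S′; counting
    -- only Light partners therefore gives the bound for heavy u as well.
    S′-out : ∀ {u} → u ∈ S′ → out u ⊆ Hubs
    S′-out {u} u∈ {w} w∈ = ∈-select⁺ hub? (+-cancelʳ-≤ (9 * s) s (10 * h w) (begin
      10 * s                                                 ≤⟨ *-monoʳ-≤ 10 ∣S∣≤ ⟩
      10 * (∣ Light ∣ + ∣ Heavy ∣)                           ≡⟨ *-distribˡ-+ 10 ∣ Light ∣ ∣ Heavy ∣ ⟩
      10 * ∣ Light ∣ + 10 * ∣ Heavy ∣                        ≤⟨ +-mono-≤ (*-monoʳ-≤ 10 ∣Light∣≤) 10∣Heavy∣≤∣S∣ ⟩
      -- Adding 590 raises 70 to `660 = 4 * 165`, so that four copies of `large` bound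
      -- `20 * D + 660` by `8 * s`. With the `s` for heavy vertices, `9 * s` cancels, and
      -- `s ≤ 10 * h w` is the definition of a hub.
      10 * (7 + D + (h w + D) + 0) + s                       ≤⟨ +-monoˡ-≤ s (m≤m+n _ 590) ⟩
      10 * (7 + D + (h w + D) + 0) + 590 + s                 ≡⟨ solve 3 (λ d x s → con 10 :* (con 7 :+ d :+ (x :+ d) :+ con 0) :+ con 590 :+ s :=
                                                                  con 10 :* x :+ (con 4 :* (con 5 :* d :+ con 165) :+ s)) refl D (h w) s ⟩
      10 * h w + (4 * (5 * D + 165) + s)                     ≤⟨ +-monoʳ-≤ (10 * h w) (+-monoˡ-≤ s (*-monoʳ-≤ 4 large)) ⟩
      10 * h w + (4 * (2 * s) + s)                           ≡⟨ solve 2 (λ x s → con 10 :* x :+ (con 4 :* (con 2 :* s) :+ s) :=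
                                                                  con 10 :* x :+ con 9 :* s) refl (h w) s ⟩
      10 * h w + 9 * s                                       ∎))
      where
      open ≤-Reasoning
      open +-*-Solver
      s = ∣ S ∣
      ∣S∣≤ : s ≤ ∣ Light ∣ + ∣ Heavy ∣
      ∣S∣≤ = ≤-trans (p⊆q⇒∣p∣≤∣q∣ split) (∣p∪q∣≤∣p∣+∣q∣ Light Heavy)
        where
        split : S ⊆ Light ∪ Heavy
        split {v} v∈ with heavy? v
        ... | yes heavy = q⊆p∪q Light Heavy (∈-select⁺ heavy? heavy)
        ... | no ¬heavy = p⊆p∪q Heavy (∈-select⁺ light? (v∈ , ¬heavy))
      ∣Light∣≤ : ∣ Light ∣ ≤ 7 + D + (h w + D) + 0
      ∣Light∣≤ = ≤-trans (∣N∣≤h+ (S′⊆S u∈) w∈ Light (proj₁ ∘ ∈-select⁻ light?))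
        (+-monoʳ-≤ (7 + D + (h w + D)) (walks-Light u∈))

    -- Each hub receives at least a tenth of `∣ S ∣` out of at most `2 * ∣ S ∣` arcs leaving `S`;
    -- `large` makes `∣ S ∣` positive.
    ∣Hubs∣≤20 : ∣ Hubs ∣ ≤ 20
    ∣Hubs∣≤20 = *-cancelˡ-≤ ∣ S ∣ (begin
      ∣ S ∣ * ∣ Hubs ∣           ≤⟨ markov (λ w → 10 * h w) ∣ S ∣ ⟩
      sum (λ w → 10 * h w)       ≡⟨ *-distribˡ-sum 10 h ⟨
      10 * sum h                 ≤⟨ *-monoʳ-≤ 10 sum-h ⟩
      10 * (2 * ∣ S ∣)           ≡⟨ *-assoc 10 2 ∣ S ∣ ⟨
      20 * ∣ S ∣                 ≡⟨ *-comm 20 ∣ S ∣ ⟩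
      ∣ S ∣ * 20                 ∎)
      where
      open ≤-Reasoning
      instance
        nonZero : NonZero ∣ S ∣
        nonZero = >-nonZero (*-cancelˡ-< 2 0 ∣ S ∣ (<-≤-trans (≤-trans (s≤s z≤n) (m≤n+m 165 (5 * D))) large))

    ∣S∣≤∣S′∣+60 : ∣ S ∣ ≤ ∣ S′ ∣ + 60
    ∣S∣≤∣S′∣+60 = begin
      ∣ S ∣                                        ≤⟨ p⊆q⇒∣p∣≤∣q∣ split ⟩
      ∣ S′ ∪ Exceptional ∣                         ≤⟨ ∣p∪q∣≤∣p∣+∣q∣ S′ Exceptional ⟩
      ∣ S′ ∣ + ∣ Exceptional ∣                     ≤⟨ +-monoʳ-≤ ∣ S′ ∣ (∣p∪q∣≤∣p∣+∣q∣ Hubs (⋃∈ Hubs out)) ⟩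
      ∣ S′ ∣ + (∣ Hubs ∣ + ∣ ⋃∈ Hubs out ∣)        ≤⟨ +-monoʳ-≤ ∣ S′ ∣ (+-monoʳ-≤ ∣ Hubs ∣
                                                        (≤-trans (∣⋃∈∣≤∑∈ Hubs out) (∑∈-bound Hubs 2 (λ {w} _ → bounded w)))) ⟩
      ∣ S′ ∣ + 3 * ∣ Hubs ∣                        ≤⟨ +-monoʳ-≤ ∣ S′ ∣ (*-monoʳ-≤ 3 ∣Hubs∣≤20) ⟩
      ∣ S′ ∣ + 60                                  ∎
      where
      open ≤-Reasoning
      split : S ⊆ S′ ∪ Exceptional
      split {v} v∈ with v ∈? Exceptional
      ... | yes v∈E = q⊆p∪q S′ Exceptional v∈E
      ... | no v∉E  = p⊆p∪q Exceptional (x∈p∧x∉q⇒x∈p─q v∈ v∉E)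

    -- On a path of length at most two between vertices of `S′` every edge touches `S′`, so keeping
    -- these edges preserves the clique in the square.
    G′ : Graph n
    G′ = record
      { V          = V G
      ; Adj        = λ u v → Adj G u v × (u ∈ S′ ⊎ v ∈ S′)
      ; Adj?       = λ u v → Adj? G u v ×-dec ((u ∈? S′) ⊎-dec (v ∈? S′))
      ; Adj-sym    = λ (uv , touches) → Adj-sym G uv , Sum.swap touches
      ; Adj-irrefl = λ u≡v (uv , _) → Adj-irrefl G u≡v uv
      ; Adj⇒∈V     = λ (uv , _) → Adj⇒∈V G uv
      }

    rank : Fin n → ℕ
    rank v = if does (v ∈? Hubs) then 0 else if does (v ∈? S′) then 1 else 2

    rank-Hubs : ∀ {v} → v ∈ Hubs → rank v ≡ 0
    rank-Hubs {v} v∈ with v ∈? Hubs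
    ... | yes _ = refl
    ... | no v∉ = contradiction v∈ v∉

    rank-S′ : ∀ {v} → v ∈ S′ → rank v ≡ 1
    rank-S′ {v} v∈ with v ∈? Hubs | v ∈? S′
    ... | yes v∈Hubs | _      = contradiction v∈Hubs (S′∉Hubs v∈)
    ... | no _       | yes _  = refl
    ... | no _       | no v∉  = contradiction v∈ v∉

    rank≤1 : ∀ {v} → rank v ≤ 1 → v ∈ Hubs ⊎ v ∈ S′
    rank≤1 {v} r≤1 with v ∈? Hubs | v ∈? S′ | r≤1
    ... | yes v∈ | _      | _ = inj₁ v∈
    ... | no _   | yes v∈ | _ = inj₂ v∈
    ... | no _   | no _   | s≤s ()

    -- Suppose instead that the arc goes from `w` to `v`. If `w` is in `S′`, then `v` is a hub and
    -- has smaller rank. If `v` is in `S′`, then `w` is in `S′`, as before, or a hub, and hubs send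
    -- no arcs into `S′`.
    lower : ∀ {v w} → Adj G′ v w → rank w ≤ rank v → w ∈ out v
    lower {v} {w} (vw , touches) r≤r with covers vw
    ... | inj₁ w∈out = w∈out
    ... | inj₂ v∈out = contradiction touches [ v∉S′ , w∉S′ ]′
      where
      w∉S′ : w ∉ S′
      w∉S′ w∈ = contradiction (subst₂ _≤_ (rank-S′ w∈) (rank-Hubs (S′-out w∈ v∈out)) r≤r) λ ()
      v∉S′ : v ∉ S′
      v∉S′ v∈ = [ (λ w∈Hubs → S′∉outHubs v∈ w∈Hubs v∈out) , w∉S′ ]′
        (rank≤1 (≤-trans r≤r (≤-reflexive (rank-S′ v∈))))

    G′-degenerate : Degenerate 2 G′
    G′-degenerate = rank⇒degenerate G′ rank out bounded lower

    deg-G′≤D : ∀ v → deg G′ v ≤ D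
    deg-G′≤D v = begin
      deg G′ v                                  ≡⟨ deg≡sum G′ v ⟩
      sum (λ w → 𝟙 (Adj? G′ v w))               ≤⟨ sum-mono (λ w → 𝟙-mono (Adj? G′ v w) (Adj? G v w) proj₁) ⟩
      sum (λ w → 𝟙 (Adj? G v w))                ≡⟨ deg≡sum G v ⟨
      deg G v                                   ≤⟨ deg≤D v ⟩
      D                                         ∎
      where open ≤-Reasoning

    S′-clique : IsClique (G′ ²) S′
    S′-clique = record { ⊆V = IsClique.⊆V S-clique ∘ S′⊆S ; adjacent = adjacent′ }
      where
      adjacent′ : ∀ {u v} → u ∈ S′ → v ∈ S′ → u ≢ v → Adj (G′ ²) u v
      adjacent′ u∈ v∈ u≢v with IsClique.adjacent S-clique (S′⊆S u∈) (S′⊆S v∈) u≢v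
      ... | inj₁ uv = inj₁ (uv , inj₁ u∈)
      ... | inj₂ (_ , ¬uv , w , uw , wv) =
        inj₂ (u≢v , ¬uv ∘ proj₁ , w , (uw , inj₁ u∈) , (wv , inj₂ v∈))

-- The lower bound

injective⇒≤∣p∣ : (p : Subset n) (f : Fin m → Fin n) → Injective _≡_ _≡_ f →
                 (∀ i → f i ∈ p) → m ≤ ∣ p ∣
injective⇒≤∣p∣ {m = zero}  p f inj f∈p = z≤n
injective⇒≤∣p∣ {m = suc m} p f inj f∈p =
  ≤-<-trans
    (injective⇒≤∣p∣ (p - f zero) (f ∘ suc) (Fin.suc-injective ∘ inj)
      (λ i → x∈p∧x≢y⇒x∈p-y (f∈p (suc i)) (λ eq → contradiction (inj eq) λ ())))
    (x∈p⇒∣p-x∣<∣p∣ (f∈p zero))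

image : (Fin m → Fin n) → Subset n
image f = ⋃∈ ⊤ (⁅_⁆ ∘ f)

∈-image : (f : Fin m → Fin n) (i : Fin m) → f i ∈ image f
∈-image f i = ∈-⋃∈⁺ ⊤ (⁅_⁆ ∘ f) ∈⊤ (x∈⁅x⁆ (f i))

∣image∣≤ : (f : Fin m → Fin n) → ∣ image f ∣ ≤ m
∣image∣≤ {m = m} f = begin
  ∣ image f ∣              ≤⟨ ∣⋃∈∣≤∑∈ ⊤ (⁅_⁆ ∘ f) ⟩
  ∑∈ ⊤ (∣_∣ ∘ ⁅_⁆ ∘ f)     ≤⟨ ∑∈-bound ⊤ 1 (λ {i} _ → ≤-reflexive (∣⁅x⁆∣≡1 (f i))) ⟩
  1 * ∣ ⊤ {m} ∣            ≡⟨ *-identityˡ _ ⟩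
  ∣ ⊤ {m} ∣                ≡⟨ ∣⊤∣≡n m ⟩
  m                        ∎
  where open ≤-Reasoning

-- The pentagon with every edge replaced by m branch vertices, the branches over disjoint
-- edges of the pentagon being joined pairwise by paths of length two.
module Pentagon (m : ℕ) where

  Vertex : Set
  Vertex = Fin 5 ⊎ (Fin 5 × Fin m) ⊎ (Fin 5 × (Fin m × Fin m))

  pattern hub i      = inj₁ i
  pattern branch i a = inj₂ (inj₁ (i , a))
  pattern link i a b = inj₂ (inj₂ (i , a , b))

  _≟ⱽ_ : DecidableEquality Vertex
  _≟ⱽ_ = ⊎.≡-dec _≟_ (⊎.≡-dec (×.≡-dec _≟_ _≟_) (×.≡-dec _≟_ (×.≡-dec _≟_ _≟_)))

  next : Fin 5 → Fin 5
  next 0F = 1F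
  next 1F = 2F
  next 2F = 3F
  next 3F = 4F
  next 4F = 0F

  next² next³ next⁴ : Fin 5 → Fin 5
  next² = next ∘ next
  next³ = next ∘ next²
  next⁴ = next ∘ next³

  next⁵≡id : ∀ i → next (next⁴ i) ≡ i
  next⁵≡id 0F = refl
  next⁵≡id 1F = refl
  next⁵≡id 2F = refl
  next⁵≡id 3F = refl
  next⁵≡id 4F = refl

  -- Edges of a pentagon either share an end or lie two places apart; the 25 pairs are checked by
  -- evaluation.
  position : ∀ i j → (i ≡ j ⊎ next i ≡ j ⊎ i ≡ next j) ⊎ (next² i ≡ j ⊎ i ≡ next² j)
  position = from-yes (all? λ i → all? λ j →
    ((i ≟ j) ⊎-dec (next i ≟ j) ⊎-dec (i ≟ next j)) ⊎-dec ((next² i ≟ j) ⊎-dec (i ≟ next² j)))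

  -- Every pair of disjoint pentagon edges is `i`, `next² i` for exactly one `i`, so each pair of
  -- branches over disjoint edges gets a single link.
  Parent : Rel Vertex 0ℓ
  Parent y (hub i)      = Empty.⊥
  Parent y (branch i a) = y ≡ hub i ⊎ y ≡ hub (next i)
  Parent y (link i a b) = y ≡ branch i a ⊎ y ≡ branch (next² i) b

  Parent? : Decidable Parent
  Parent? y (hub i)      = no λ ()
  Parent? y (branch i a) = (y ≟ⱽ hub i) ⊎-dec (y ≟ⱽ hub (next i))
  Parent? y (link i a b) = (y ≟ⱽ branch i a) ⊎-dec (y ≟ⱽ branch (next² i) b)

  level : Vertex → ℕ
  level (hub _)      = 0
  level (branch _ _) = 1
  level (link _ _ _) = 2

  Parent⇒level : ∀ y x → Parent y x → level y < level x
  Parent⇒level _ (branch i a) (inj₁ refl) = ≤-refl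
  Parent⇒level _ (branch i a) (inj₂ refl) = ≤-refl
  Parent⇒level _ (link i a b) (inj₁ refl) = ≤-refl
  Parent⇒level _ (link i a b) (inj₂ refl) = ≤-refl

  order : ℕ
  order = 5 + (5 * m + 5 * (m * m))

  abstract
    -- Only bijectivity matters; `abstract` keeps the explicit numbering from unfolding.
    iso : Fin order ↔ Vertex
    iso = ↔-trans +↔⊎ (↔-refl ⊎-↔ ↔-trans +↔⊎ (*↔× ⊎-↔ ↔-trans *↔× (↔-refl ×-↔ *↔×)))

  open Inverse iso using (to; from)

  to∘from : ∀ x → to (from x) ≡ x
  to∘from = Inverse.strictlyInverseˡ iso

  from∘to : ∀ v → from (to v) ≡ v
  from∘to = Inverse.strictlyInverseʳ iso

  Linked : Rel Vertex 0ℓ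
  Linked x y = Parent x y ⊎ Parent y x

  G₅ : Graph order
  G₅ = record
    { V          = ⊤
    ; Adj        = λ u v → Linked (to u) (to v)
    ; Adj?       = λ u v → Parent? (to u) (to v) ⊎-dec Parent? (to v) (to u)
    ; Adj-sym    = Sum.swap
    ; Adj-irrefl = λ { {u} refl → [ irrefl u , irrefl u ]′ }
    ; Adj⇒∈V     = λ _ → ∈⊤
    }
    where
    irrefl : ∀ u → ¬ Parent (to u) (to u)
    irrefl u p = <-irrefl refl (Parent⇒level (to u) (to u) p)

  to≡⇒≡from : ∀ {v x} → to v ≡ x → v ≡ from x
  to≡⇒≡from refl = sym (from∘to _)

  pair : Vertex → Vertex → Subset order
  pair x y = ⁅ from x ⁆ ∪ ⁅ from y ⁆

  ∣pair∣≤2 : ∀ x y → ∣ pair x y ∣ ≤ 2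
  ∣pair∣≤2 x y = ≤-trans (∣p∪q∣≤∣p∣+∣q∣ ⁅ from x ⁆ ⁅ from y ⁆)
    (≤-reflexive (cong₂ _+_ (∣⁅x⁆∣≡1 (from x)) (∣⁅x⁆∣≡1 (from y))))

  ∈-pair : ∀ {v} x y → to v ≡ x ⊎ to v ≡ y → v ∈ pair x y
  ∈-pair x y (inj₁ v≡x) = subst (_∈ pair x y) (sym (to≡⇒≡from v≡x)) (p⊆p∪q ⁅ from y ⁆ (x∈⁅x⁆ (from x)))
  ∈-pair x y (inj₂ v≡y) = subst (_∈ pair x y) (sym (to≡⇒≡from v≡y)) (q⊆p∪q ⁅ from x ⁆ ⁅ from y ⁆ (x∈⁅x⁆ (from y)))

  parents : Vertex → Subset order
  parents (hub i)      = ⊥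
  parents (branch i a) = pair (hub i) (hub (next i))
  parents (link i a b) = pair (branch i a) (branch (next² i) b)

  ∣parents∣≤2 : ∀ x → ∣ parents x ∣ ≤ 2
  ∣parents∣≤2 (hub i)      = ≤-trans (≤-reflexive (∣⊥∣≡0 order)) z≤n
  ∣parents∣≤2 (branch i a) = ∣pair∣≤2 (hub i) (hub (next i))
  ∣parents∣≤2 (link i a b) = ∣pair∣≤2 (branch i a) (branch (next² i) b)

  Parent⇒∈parents : ∀ {v} x → Parent (to v) x → v ∈ parents x
  Parent⇒∈parents (branch i a) = ∈-pair (hub i) (hub (next i))
  Parent⇒∈parents (link i a b) = ∈-pair (branch i a) (branch (next² i) b)

  G₅-degenerate : Degenerate 2 G₅
  G₅-degenerate = rank⇒degenerate G₅ (level ∘ to) (parents ∘ to) (∣parents∣≤2 ∘ to) lower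
    where
    lower : ∀ {v w} → Linked (to v) (to w) → level (to w) ≤ level (to v) → w ∈ parents (to v)
    lower {v} {w} (inj₁ v-parent) r≤r = contradiction r≤r (<⇒≱ (Parent⇒level (to v) (to w) v-parent))
    lower {v}     (inj₂ w-parent) _   = Parent⇒∈parents (to v) w-parent

  images : (f g : Fin m → Vertex) → Subset order
  images f g = image (from ∘ f) ∪ image (from ∘ g)

  ∣images∣≤ : ∀ f g → ∣ images f g ∣ ≤ m + m
  ∣images∣≤ f g = ≤-trans (∣p∪q∣≤∣p∣+∣q∣ (image (from ∘ f)) (image (from ∘ g)))
    (+-mono-≤ (∣image∣≤ (from ∘ f)) (∣image∣≤ (from ∘ g)))

  ∈-images₁ : ∀ {v} f g a → to v ≡ f a → v ∈ images f g
  ∈-images₁ f g a v≡ = subst (_∈ images f g) (sym (to≡⇒≡from v≡))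
    (p⊆p∪q (image (from ∘ g)) (∈-image (from ∘ f) a))

  ∈-images₂ : ∀ {v} f g a → to v ≡ g a → v ∈ images f g
  ∈-images₂ f g a v≡ = subst (_∈ images f g) (sym (to≡⇒≡from v≡))
    (q⊆p∪q (image (from ∘ f)) (image (from ∘ g)) (∈-image (from ∘ g) a))

  -- Modulo 5, `next⁴` inverts `next` and `next³` inverts `next²`: hub `i` also ends edge `next⁴ i`,
  -- and a branch over `i` is the second parent of links indexed by `next³ i`.
  children : Vertex → Subset order
  children (hub i)      = images (branch i) (branch (next⁴ i))
  children (branch i a) = images (link i a) (λ b → link (next³ i) b a)
  children (link i a b) = ⊥

  Parent⇒∈children : ∀ x {v} y → to v ≡ y → Parent x y → v ∈ children x
  Parent⇒∈children _ (branch i a) eq (inj₁ refl) = ∈-images₁ (branch i) (branch (next⁴ i)) a eq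
  Parent⇒∈children _ (branch i a) eq (inj₂ refl) =
    ∈-images₂ (branch (next i)) (branch (next⁴ (next i))) a
      (trans eq (cong (λ j → branch j a) (sym (next⁵≡id i))))
  Parent⇒∈children _ (link i a b) eq (inj₁ refl) = ∈-images₁ (link i a) (λ b → link (next³ i) b a) b eq
  Parent⇒∈children _ (link i a b) eq (inj₂ refl) =
    ∈-images₂ (link (next² i) b) (λ c → link (next³ (next² i)) c b) a
      (trans eq (cong (λ j → link j a b) (sym (next⁵≡id i))))

  N⊆parents∪children : ∀ {v w} → Linked (to v) (to w) → w ∈ parents (to v) ∪ children (to v)
  N⊆parents∪children {v} {w} (inj₁ v-parent) =
    q⊆p∪q (parents (to v)) (children (to v)) (Parent⇒∈children (to v) (to w) refl v-parent)
  N⊆parents∪children {v} (inj₂ w-parent) =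
    p⊆p∪q (children (to v)) (Parent⇒∈parents (to v) w-parent)

  -- Branches have the largest bound: two hubs and `m + m` links. The alternative `m ≡ 0` serves
  -- small `D`; then only isolated hubs exist.
  ∣parents∪children∣≤ : ∀ {D} → m ≡ 0 ⊎ 2 + (m + m) ≤ D → ∀ x →
                        ∣ parents x ∪ children x ∣ ≤ D
  ∣parents∪children∣≤ {D} large x = ≤-trans (∣p∪q∣≤∣p∣+∣q∣ (parents x) (children x)) (bound x large)
    where
    open ≤-Reasoning
    bound : ∀ x → m ≡ 0 ⊎ 2 + (m + m) ≤ D → ∣ parents x ∣ + ∣ children x ∣ ≤ D
    bound (hub i) (inj₁ refl) = begin
      ∣ ⊥ {order} ∣ + ∣ children (hub i) ∣     ≤⟨ +-mono-≤ (≤-reflexive (∣⊥∣≡0 order)) (∣images∣≤ (branch i) (branch (next⁴ i))) ⟩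
      0                                    ≤⟨ z≤n ⟩
      D                                    ∎
    bound (hub i) (inj₂ 2+2m≤D) = begin
      ∣ ⊥ {order} ∣ + ∣ children (hub i) ∣     ≤⟨ +-mono-≤ (≤-reflexive (∣⊥∣≡0 order)) (∣images∣≤ (branch i) (branch (next⁴ i))) ⟩
      m + m                                ≤⟨ m≤n+m (m + m) 2 ⟩
      2 + (m + m)                          ≤⟨ 2+2m≤D ⟩
      D                                    ∎
    bound (branch i ()) (inj₁ refl)
    bound (branch i a) (inj₂ 2+2m≤D) = ≤-trans
      (+-mono-≤ (∣parents∣≤2 (branch i a)) (∣images∣≤ (link i a) (λ b → link (next³ i) b a))) 2+2m≤D
    bound (link i () b) (inj₁ refl)
    bound (link i a b) (inj₂ 2+2m≤D) = ≤-trans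
      (+-mono-≤ (∣parents∣≤2 (link i a b)) (≤-trans (≤-reflexive (∣⊥∣≡0 order)) z≤n)) 2+2m≤D

  ΔG₅≤D : ∀ {D} → m ≡ 0 ⊎ 2 + (m + m) ≤ D → Δ G₅ ≤ D
  ΔG₅≤D fits = deg≤⇒Δ≤ G₅ (λ v →
    ≤-trans (deg≤∣p∣ G₅ _ (N⊆parents∪children {v})) (∣parents∪children∣≤ fits (to v)))

  isBranch? : Decidable₁ (λ v → ∃[ i ] ∃[ a ] to v ≡ branch i a)
  isBranch? v with to v
  ... | hub _      = no λ ()
  ... | branch i a = yes (i , a , refl)
  ... | link _ _ _ = no λ ()

  S₅ : Subset order
  S₅ = select isBranch?

  5m≤∣S₅∣ : 5 * m ≤ ∣ S₅ ∣
  5m≤∣S₅∣ = injective⇒≤∣p∣ S₅ (from ∘ inj₂ ∘ inj₁ ∘ Inverse.to *↔×)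
    (Injection.injective (↔⇒↣ *↔×) ∘ ⊎.inj₁-injective ∘ ⊎.inj₂-injective ∘ Injection.injective (↔⇒↣ (↔-sym iso)))
    (λ i → ∈-select⁺ isBranch? (_ , _ , to∘from _))

  S₅-clique : IsClique (G₅ ²) S₅
  S₅-clique = record { ⊆V = λ _ → ∈⊤ ; adjacent = adjacent }
    where
    -- Branches over equal or consecutive pentagon edges share a hub; those over disjoint edges
    -- share a link.
    joined : ∀ {i a j b} → ∃[ z ] Linked (branch i a) z × Linked z (branch j b)
    joined {i} {a} {j} {b} with position i j
    ... | inj₁ (inj₁ refl)        = hub i , inj₂ (inj₁ refl) , inj₁ (inj₁ refl)
    ... | inj₁ (inj₂ (inj₁ refl)) = hub j , inj₂ (inj₂ refl) , inj₁ (inj₁ refl)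
    ... | inj₁ (inj₂ (inj₂ refl)) = hub i , inj₂ (inj₁ refl) , inj₁ (inj₂ refl)
    ... | inj₂ (inj₁ refl)        = link i a b , inj₁ (inj₁ refl) , inj₂ (inj₂ refl)
    ... | inj₂ (inj₂ refl)        = link j b a , inj₁ (inj₂ refl) , inj₂ (inj₁ refl)

    adjacent : ∀ {u v} → u ∈ S₅ → v ∈ S₅ → u ≢ v → Adj (G₅ ²) u v
    adjacent {u} {v} u∈ v∈ u≢v with ∈-select⁻ isBranch? u∈ | ∈-select⁻ isBranch? v∈
    ... | i , a , u≡ | j , b , v≡ with joined {i} {a} {j} {b}
    ...   | z , uz , zv = inj₂
      ( u≢v
      , subst₂ (λ x y → ¬ Linked x y) (sym u≡) (sym v≡)
          (λ { (inj₁ (inj₁ ())) ; (inj₁ (inj₂ ())) ; (inj₂ (inj₁ ())) ; (inj₂ (inj₂ ())) })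
      , from z
      , subst₂ Linked (sym u≡) (sym (to∘from z)) uz
      , subst₂ Linked (sym (to∘from z)) (sym v≡) zv)

-- Choosing between the pentagon and the reduction

halve : ∀ D → ∃[ m ] (m ≡ 0 ⊎ 2 + (m + m) ≤ D) × D ≤ 3 + (m + m)
halve 0 = 0 , inj₁ refl , z≤n
halve 1 = 0 , inj₁ refl , s≤s z≤n
-- From `D = 4` on, raising `D` by two raises `m` by one; below 4 it stays 0. So `m` is `D / 2 - 1`,
-- rounded down and cut off at 0.
halve (suc (suc D)) with halve D
... | m , large , D≤ with D
...   | 0 = 0 , inj₁ refl , s≤s (s≤s z≤n)
...   | 1 = 0 , inj₁ refl , s≤s (s≤s (s≤s z≤n))
...   | suc (suc D″) = suc m , inj₂ (s≤s (s≤s (grow large))) ,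
        s≤s (s≤s (subst (λ k → suc (suc D″) ≤ suc (suc k)) (sym (+-suc m m)) D≤))
  where
  grow : m ≡ 0 ⊎ 2 + (m + m) ≤ suc (suc D″) → suc (m + suc m) ≤ suc (suc D″)
  grow (inj₁ refl) = s≤s (s≤s z≤n)
  grow (inj₂ le)   = ≤-trans (≤-reflexive (cong suc (+-suc m m))) le

-- The pentagon has a clique of `5 * m` vertices, enough if `s` exceeds this by at most 460.
-- Otherwise `2 * s ≥ 10 * m + 922`, whereas `5 * D + 165 ≤ 10 * m + 180`; the difference is 742.
small⊎large : ∀ D s → (∃[ m ] (m ≡ 0 ⊎ 2 + (m + m) ≤ D) × s ≤ 5 * m + 460) ⊎ 5 * D + 165 ≤ 2 * s
small⊎large D s with halve D
... | m , fits , D≤3+2m with s ≤? 5 * m + 460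
...   | yes s≤ = inj₁ (m , fits , s≤)
...   | no s≰  = inj₂ (begin
  5 * D + 165                      ≤⟨ +-monoˡ-≤ 165 (*-monoʳ-≤ 5 D≤3+2m) ⟩
  5 * (3 + (m + m)) + 165          ≤⟨ m≤m+n _ 742 ⟩
  5 * (3 + (m + m)) + 165 + 742    ≡⟨ solve 1 (λ m → con 5 :* (con 3 :+ (m :+ m)) :+ con 165 :+ con 742 :=
                                                 con 2 :* (con 1 :+ (con 5 :* m :+ con 460))) refl m ⟩
  2 * suc (5 * m + 460)            ≤⟨ *-monoʳ-≤ 2 (≰⇒> s≰) ⟩
  2 * s                            ∎)
  where
  open ≤-Reasoning
  open +-*-Solver

Realised : ℕ → ℕ → Set₁
Realised D g =
  ∃[ n ] Σ[ G ∈ Graph n ] Degenerate 2 G × Δ G ≤ D × (∃[ S ] IsClique (G ²) S × ∣ S ∣ + 460 ≥ g)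

pentagon-realises : ∀ {D g} m → m ≡ 0 ⊎ 2 + (m + m) ≤ D → g ≤ 5 * m + 460 → Realised D g
pentagon-realises m fits g≤ =
  order , G₅ , G₅-degenerate , ΔG₅≤D fits , S₅ , S₅-clique , ≤-trans g≤ (+-monoˡ-≤ 460 5m≤∣S₅∣)
  where open Pentagon m

reduction-realises : ∀ (G : Graph n) {D} → Mad< G (ℤ.+ 4 ℚ./ 1) → Δ G ≤ D → ∀ S → IsClique (G ²) S →
                     5 * D + 165 ≤ 2 * ∣ S ∣ → Realised D ∣ S ∣
reduction-realises G mad<4 Δ≤D S S-clique large with orientation (mad<4⇒sparse G mad<4)
... | o , bounded , covers =
  _ , G′ large , G′-degenerate large , deg≤⇒Δ≤ (G′ large) (deg-G′≤D large) ,
  S′ large , S′-clique large ,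
  -- The reduction loses at most 60 vertices, within the allowance `60 + 400 = 460`.
  ≤-trans (∣S∣≤∣S′∣+60 large) (+-monoʳ-≤ ∣ S′ large ∣ (m≤m+n 60 400))
  where open Reduction G o bounded covers (Δ≤⇒deg≤ G Δ≤D) S-clique

theorem4 : (D : ℕ) → D ≥ 1 → (g : ℕ) → IsG D g →
    ∃[ n ] Σ[ G ∈ Graph n ] Degenerate 2 G × Δ G ≤ D ×
    (∃[ S′ ] IsClique (G ²) S′ × ∣ S′ ∣ + 460 ≥ g)
theorem4 D _ g ((_ , G , mad<4 , Δ≤D , S , S-clique , ∣S∣≡g) , _) =
  [ (λ (m , fits , g≤) → pentagon-realises m fits g≤)
  , (λ large → subst (Realised D) ∣S∣≡g
       (reduction-realises G mad<4 Δ≤D S S-clique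
         (subst (λ s → 5 * D + 165 ≤ 2 * s) (sym ∣S∣≡g) large)))
  ]′ (small⊎large D g)
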